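{- Let $q$ be a prime power and let $M$ be a spike of rank $n>q^3$ with ground set $E$. If $\mathcal{X}$ is a collection of subsets of $E$ such that every matroid $N$ on $E$ with $r_N(X)=r_M(X)$ for all $X\in\mathcal{X}$ is $GF(q)$-representable, then $|\mathcal{X}|\ge 2^{n/2}$. That is, proving that $M$ is $GF(q)$-representable requires at least $2^{n/2}$ rank values.
   Context: Let $n\ge 3$. Let $N$ be a rank-$n$ matroid with ground set $\{t,a_1,b_1,\dots,a_n,b_n\}$ such that (i) $\{t,a_i,b_i\}$ is a triangle (3-element circuit) for every $i\in\{1,\dots,n\}$, and (ii) $r(\bigcup_{j\in J}\{a_j,b_j\})=|J|+1$ for every nonempty proper subset $J$ of $\{1,\dots,n\}$. Then $M=N\setminus t$ is called a rank-$n$ spike, and the pairs $\{a_i,b_i\}$ are its legs. A rank value/rank evaluation is the value $r_M(X)$ for a subset $X$. -}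

module Defs where

open import Data.Nat using (ℕ; zero; suc; _^_; _≤_; _<_; _≥_)
open import Data.Nat as ℕ using ()
open import Data.Nat.Primality using (Prime)
open import Data.Fin using (Fin)
open import Data.Fin as Fin using ()
open import Data.Fin.Subset using (Subset; _⊆_; _⊂_; _∪_; _∩_; ∣_∣; ⁅_⁆; ⊤; Nonempty; _∈_; inside; outside)
open import Data.Vec using (Vec; _∷_; _++_)
open import Data.Product using (Σ; ∃; ∃-syntax; _×_; _,_)
open import Relation.Nullary using (¬_)
open import Relation.Binary.PropositionalEquality using (_≡_)
open import Algebra.Bundles using (CommutativeRing)
open import Level using (0ℓ)

IsPrimePower : ℕ → Set
IsPrimePower q = Σ ℕ λ p → Σ ℕ λ k → Prime p × 1 ≤ k × q ≡ p ^ k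

RankFn : ℕ → Set
RankFn m = Subset m → ℕ

record IsMatroid {m : ℕ} (r : RankFn m) : Set where
  field
    bounded      : ∀ X → r X ≤ ∣ X ∣
    monotone     : ∀ X Y → X ⊆ Y → r X ≤ r Y
    submodular   : ∀ X Y → r (X ∪ Y) ℕ.+ r (X ∩ Y) ≤ r X ℕ.+ r Y

Independent : ∀ {m} → RankFn m → Subset m → Set
Independent r X = r X ≡ ∣ X ∣

IsCircuit : ∀ {m} → RankFn m → Subset m → Set
IsCircuit r C = ¬ Independent r C × (∀ Y → Y ⊂ C → Independent r Y)

rankOf : ∀ {m} → RankFn m → ℕ
rankOf r = r ⊤

-- Spikes.
-- For a spike of rank n the ground set E is Fin (n + n), where
--   a_i = Fin.inject+ n i   and   b_i = Fin.raise n i   (i : Fin n),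
-- so for J : Subset n the set ⋃_{j∈J} {a_j , b_j} is  J ++ J.
-- The auxiliary matroid N lives on Fin (suc (n + n)) with t = zero,
-- so a subset X of E corresponds to  outside ∷ X  (t ∉) and the
-- subset X ∪ {t} to  inside ∷ X.

legs : ∀ {n} → Subset n → Subset (n ℕ.+ n)
legs J = J ++ J

ProperSubset : ∀ {n} → Subset n → Set
ProperSubset J = ¬ (J ≡ ⊤)

IsSpikeExtension : (n : ℕ) → RankFn (suc (n ℕ.+ n)) → Set
IsSpikeExtension n rN =
  IsMatroid rN ×
  rankOf rN ≡ n ×
  (∀ (i : Fin n) → IsCircuit rN (inside ∷ legs ⁅ i ⁆)) ×
  (∀ (J : Subset n) → Nonempty J → ProperSubset J →
     rN (outside ∷ legs J) ≡ ∣ J ∣ ℕ.+ 1)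

IsSpike : (n : ℕ) → RankFn (n ℕ.+ n) → Set
IsSpike n rM =
  3 ≤ n ×
  Σ (RankFn (suc (n ℕ.+ n))) λ rN →
    IsSpikeExtension n rN × (∀ X → rM X ≡ rN (outside ∷ X))

record IsField (F : CommutativeRing 0ℓ 0ℓ) : Set where
  open CommutativeRing F using (Carrier; _≈_; _+_; _*_; 0#; 1#)
  field
    nontrivial : ¬ (1# ≈ 0#)
    inverse    : ∀ x → ¬ (x ≈ 0#) → ∃[ y ] (x * y ≈ 1#)

HasOrder : CommutativeRing 0ℓ 0ℓ → ℕ → Set
HasOrder F q = let open CommutativeRing F in
  Σ (Fin q → Carrier) λ f →
    (∀ i j → f i ≈ f j → i ≡ j) × (∀ x → ∃[ i ] (f i ≈ x))

module _ (F : CommutativeRing 0ℓ 0ℓ) where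
  open CommutativeRing F using (Carrier; _≈_; _+_; _*_; 0#; 1#)

  ∑ : ∀ {m} → (Fin m → Carrier) → Carrier
  ∑ {ℕ.zero}  g = 0#
  ∑ {ℕ.suc m} g = g Fin.zero + ∑ (λ i → g (Fin.suc i))

  Matrix : ℕ → ℕ → Set
  Matrix k m = Fin m → Fin k → Carrier

  -- the columns indexed by Y are linearly independent (a set of columns,
  -- repeated columns making it dependent, as in the column matroid)
  ColsIndependent : ∀ {k m} → Matrix k m → Subset m → Set
  ColsIndependent {k} {m} A Y =
    ∀ (c : Fin m → Carrier) →
      (∀ e → ¬ (e ∈ Y) → c e ≈ 0#) →
      (∀ row → ∑ (λ e → c e * A e row) ≈ 0#) →
      ∀ e → c e ≈ 0#

  ColRankIs : ∀ {k m} → Matrix k m → Subset m → ℕ → Set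
  ColRankIs A X ρ =
    (∃[ Y ] (Y ⊆ X × ColsIndependent A Y × ∣ Y ∣ ≡ ρ)) ×
    (∀ Y → Y ⊆ X → ColsIndependent A Y → ∣ Y ∣ ≤ ρ)

  RepresentedBy : ∀ {k m} → Matrix k m → RankFn m → Set
  RepresentedBy A r = ∀ X → ColRankIs A X (r X)

-- GF(q)-representable: represented over a field with q elements
-- (all fields of order q are isomorphic to GF(q))
GFRepresentable : ℕ → ∀ {m} → RankFn m → Set₁
GFRepresentable q {m} r =
  Σ (CommutativeRing 0ℓ 0ℓ) λ F →
    IsField F × HasOrder F q ×
    Σ ℕ λ k → Σ (Matrix F k m) λ A → RepresentedBy F A r

{-# OPTIONS --safe #-}

-- Call a transversal redefinable when all its single-element exchanges are bases; its rank may
-- then be changed between n and n − 1 without leaving the class of matroids, and the result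
-- still has the leg ranks of a spike.  In a representation over GF(q) the status of the
-- transversal obtained from T by switching the legs in D depends only on Σ_{i∈D} w i for
-- suitable weights w i ∈ GF(q).  Given representations of both M and its redefinition at T, the
-- n > q² pairs of prefix sums of the two weights collide, so some nonempty D has sum zero for
-- both weights; hence T has the same status in both as the transversal switched along D, on
-- which the two matroids agree: a contradiction.  So 𝒳 contains every redefinable transversal.
-- Every neighbour of a dependent transversal is a basis, so dependent transversals are
-- redefinable, and each transversal is redefinable or next to a dependent one.  Thus
-- 2ⁿ ≤ (n + 1) |𝒳|, and (n + 1)² ≤ 2ⁿ.
module Submission where

open import Defs
open import Algebra.Bundles using (CommutativeRing)
import Algebra.Properties.Group as GroupProperties
import Algebra.Properties.Ring as RingProperties
import Algebra.Properties.Semiring.Sum as SemiringSum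
open import Data.Bool as Bool using (Bool; true; false; not; _xor_; if_then_else_)
open import Data.Bool.Properties using (not-involutive; xor-identityʳ; xor-assoc; xor-same; not-¬; ¬-not)
open import Data.Empty using () renaming (⊥ to ⊥ᵉ)
open import Data.Fin as Fin using (Fin; zero; suc; _↑ˡ_; _↑ʳ_; splitAt; punchIn; combine)
open import Data.Fin.Properties as Fin
  using (any?; all?; splitAt⁻¹-↑ˡ; splitAt⁻¹-↑ʳ; punchInᵢ≢i; pigeonhole; combine-injective)
open import Data.Fin.Subset renaming (_∈_ to _∈ₛ_; _∉_ to _∉ₛ_)
open import Data.Fin.Subset.Properties
open import Data.List using (List; []; _∷_; length; map; allFin; cartesianProductWith)
open import Data.List.Membership.DecPropositional using () renaming (_∈?_ to ∈?ˡ)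
open import Data.List.Membership.Propositional using (_∈_)
open import Data.List.Membership.Propositional.Properties using (∈-map⁺; ∈-allFin; ∈-cartesianProductWith⁺)
open import Data.List.Properties using (length-map; length-tabulate; length-++)
open import Data.List.Relation.Unary.Any using (here; there)
open import Data.List.Relation.Unary.Unique.Propositional using (Unique)
open import Data.Nat
  using ( ℕ; zero; suc; _^_; _*_; _+_; _∸_; _<_; _≤_; z≤n; s≤s; _≤?_; _<?_
        ; NonZero; >-nonZero; nonTrivial⇒n>1 )
open import Data.Nat.Primality using (prime⇒nonTrivial; prime⇒nonZero)
open import Data.Nat.Properties
open import Data.Nat.Tactic.RingSolver using (solve-∀)
open import Data.Product using (∃; ∃-syntax; ∃₂; _×_; _,_; proj₁; proj₂)
open import Data.Sum using (inj₁; inj₂; [_,_]′)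
open import Data.Vec as Vec
  using (Vec; []; _∷_; here; there; _++_; lookup; zipWith; take; drop; tabulate; replicate)
open import Data.Vec.Properties
  using ( ≡-dec; []=⇒lookup; lookup⇒[]=; lookup-++ˡ; lookup-++ʳ; lookup-map; lookup-zipWith
        ; lookup∘tabulate; lookup-replicate; zipWith-assoc; zipWith-identityʳ; ++-injectiveʳ; take++drop≡id )
open import Function using (_∘_; id)
open import Level using (0ℓ)
open import Relation.Binary.PropositionalEquality
  using (_≡_; _≢_; refl; sym; trans; cong; cong₂; subst; subst₂; module ≡-Reasoning)
open import Relation.Nullary using (¬_; Dec; yes; no; contradiction; ¬?; _×-dec_; _→-dec_; map′)
open import Relation.Nullary.Decidable using (decidable-stable)
open import Relation.Unary using (Decidable)

-- Finite subsets: witnesses, cardinalities, exchanges.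

⊈⇒∃ : ∀ {m} {p q : Subset m} → p ⊈ q → ∃[ x ] x ∈ₛ p × x ∉ₛ q
⊈⇒∃ {p = p} {q} p⊈q with any? (λ x → x ∈? p ×-dec ¬? (x ∈? q))
... | yes w = w
... | no ¬w = contradiction (λ {x} x∈p → decidable-stable (x ∈? q) λ x∉q → ¬w (x , x∈p , x∉q)) p⊈q

⊆∧≢⇒∃ : ∀ {m} {p q : Subset m} → p ⊆ q → p ≢ q → ∃[ x ] x ∈ₛ q × x ∉ₛ p
⊆∧≢⇒∃ p⊆q p≢q = ⊈⇒∃ λ q⊆p → p≢q (⊆-antisym p⊆q q⊆p)

∪-least : ∀ {m} {p q s : Subset m} → p ⊆ s → q ⊆ s → p ∪ q ⊆ s
∪-least {p = p} {q} p⊆s q⊆s = [ p⊆s , q⊆s ]′ ∘ x∈p∪q⁻ p q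

⁅⁆⊆ : ∀ {m} {p : Subset m} {x} → x ∈ₛ p → ⁅ x ⁆ ⊆ p
⁅⁆⊆ {p = p} {x} x∈p y∈ = subst (_∈ₛ p) (sym (x∈⁅y⁆⇒x≡y x y∈)) x∈p

x∉p-x : ∀ {m} {p : Subset m} {x} → x ∉ₛ p - x
x∉p-x {p = _ ∷ _} {suc x} (there x∈) = x∉p-x x∈

∣p∪q∣+∣p∩q∣ : ∀ {m} (p q : Subset m) → ∣ p ∪ q ∣ + ∣ p ∩ q ∣ ≡ ∣ p ∣ + ∣ q ∣
∣p∪q∣+∣p∩q∣ []            []            = refl
∣p∪q∣+∣p∩q∣ (outside ∷ p) (outside ∷ q) = ∣p∪q∣+∣p∩q∣ p q
∣p∪q∣+∣p∩q∣ (inside  ∷ p) (outside ∷ q) = cong suc (∣p∪q∣+∣p∩q∣ p q)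
∣p∪q∣+∣p∩q∣ (outside ∷ p) (inside  ∷ q) =
  trans (cong suc (∣p∪q∣+∣p∩q∣ p q)) (sym (+-suc ∣ p ∣ ∣ q ∣))
∣p∪q∣+∣p∩q∣ (inside  ∷ p) (inside  ∷ q) = cong suc
  (trans (+-suc _ _) (trans (cong suc (∣p∪q∣+∣p∩q∣ p q)) (sym (+-suc ∣ p ∣ ∣ q ∣))))

∣p∣+∣q─p∣≤∣q∣ : ∀ {m} {p q : Subset m} → p ⊆ q → ∣ p ∣ + ∣ q ─ p ∣ ≤ ∣ q ∣
∣p∣+∣q─p∣≤∣q∣ {p = []}          {[]}          p⊆q = z≤n
∣p∣+∣q─p∣≤∣q∣ {p = outside ∷ p} {outside ∷ q} p⊆q = ∣p∣+∣q─p∣≤∣q∣ (drop-∷-⊆ p⊆q)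
∣p∣+∣q─p∣≤∣q∣ {p = outside ∷ p} {inside  ∷ q} p⊆q =
  ≤-trans (≤-reflexive (+-suc ∣ p ∣ _)) (s≤s (∣p∣+∣q─p∣≤∣q∣ (drop-∷-⊆ p⊆q)))
∣p∣+∣q─p∣≤∣q∣ {p = inside  ∷ p} {outside ∷ q} p⊆q with () ← p⊆q here
∣p∣+∣q─p∣≤∣q∣ {p = inside  ∷ p} {inside  ∷ q} p⊆q = s≤s (∣p∣+∣q─p∣≤∣q∣ (drop-∷-⊆ p⊆q))

x∉p⇒∣p∪⁅x⁆∣≡1+∣p∣ : ∀ {m} {p : Subset m} {x} → x ∉ₛ p → ∣ p ∪ ⁅ x ⁆ ∣ ≡ suc ∣ p ∣
x∉p⇒∣p∪⁅x⁆∣≡1+∣p∣ {p = inside  ∷ p} {zero}  x∉p = contradiction here x∉p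
x∉p⇒∣p∪⁅x⁆∣≡1+∣p∣ {p = outside ∷ p} {zero}  x∉p = cong (suc ∘ ∣_∣) (∪-identityʳ p)
x∉p⇒∣p∪⁅x⁆∣≡1+∣p∣ {p = inside  ∷ p} {suc x} x∉p = cong suc (x∉p⇒∣p∪⁅x⁆∣≡1+∣p∣ (x∉p ∘ there))
x∉p⇒∣p∪⁅x⁆∣≡1+∣p∣ {p = outside ∷ p} {suc x} x∉p = x∉p⇒∣p∪⁅x⁆∣≡1+∣p∣ (x∉p ∘ there)

x∈p⇒1+∣p-x∣≡∣p∣ : ∀ {m} {p : Subset m} {x} → x ∈ₛ p → suc ∣ p - x ∣ ≡ ∣ p ∣
x∈p⇒1+∣p-x∣≡∣p∣ {p = inside  ∷ p} {zero}  here        = cong (suc ∘ ∣_∣) (p─⊥≡p p)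
x∈p⇒1+∣p-x∣≡∣p∣ {p = inside  ∷ p} {suc x} (there x∈p) = cong suc (x∈p⇒1+∣p-x∣≡∣p∣ x∈p)
x∈p⇒1+∣p-x∣≡∣p∣ {p = outside ∷ p} {suc x} (there x∈p) = x∈p⇒1+∣p-x∣≡∣p∣ x∈p

opaque
  exchange : ∀ {m} → Subset m → Fin m → Fin m → Subset m
  exchange p k e = (p - k) ∪ ⁅ e ⁆

  exchange⊆ : ∀ {m} {p s : Subset m} {k e} → p - k ⊆ s → e ∈ₛ s → exchange p k e ⊆ s
  exchange⊆ p-k⊆s e∈s = ∪-least p-k⊆s (⁅⁆⊆ e∈s)

  p-k⊆exchange : ∀ {m} {p : Subset m} {k e} → p - k ⊆ exchange p k e
  p-k⊆exchange {e = e} = p⊆p∪q ⁅ e ⁆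

  ∈exchange-new : ∀ {m} {p : Subset m} {k e} → e ∈ₛ exchange p k e
  ∈exchange-new {p = p} {k} {e} = x∈p∪q⁺ {p = p - k} (inj₂ (x∈⁅x⁆ e))

  ∣exchange∣ : ∀ {m} {p : Subset m} {k e} → k ∈ₛ p → e ∉ₛ p → ∣ exchange p k e ∣ ≡ ∣ p ∣
  ∣exchange∣ {p = p} {k} k∈p e∉p =
    trans (x∉p⇒∣p∪⁅x⁆∣≡1+∣p∣ (e∉p ∘ p─q⊆p p ⁅ k ⁆)) (x∈p⇒1+∣p-x∣≡∣p∣ k∈p)

∈exchange : ∀ {m} {p : Subset m} {x k e} → x ∈ₛ p → x ≢ k → x ∈ₛ exchange p k e
∈exchange x∈p x≢k = p-k⊆exchange (x∈p∧x≢y⇒x∈p-y x∈p x≢k)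

infix 4 _≟ₛ_

_≟ₛ_ : ∀ {m} (p q : Subset m) → Dec (p ≡ q)
_≟ₛ_ = ≡-dec Bool._≟_

-- Independence and closure from the rank axioms.

module Matroid {m} {r : RankFn m} (M : IsMatroid r) where
  open IsMatroid M
  open ≤-Reasoning

  subadditive : ∀ X Y → r (X ∪ Y) ≤ r X + r Y
  subadditive X Y = ≤-trans (m≤m+n _ _) (submodular X Y)

  -- By subadditivity `r X` is at most `r Y` plus the number of elements of `X` outside `Y`, so a
  -- deficit of `Y` would pass to `X`.
  full-rank-hereditary : ∀ {X Y} → ∣ X ∣ ≤ r X → Y ⊆ X → ∣ Y ∣ ≤ r Y
  full-rank-hereditary {X} {Y} X-indep Y⊆X = +-cancelʳ-≤ ∣ X ─ Y ∣ ∣ Y ∣ (r Y) (begin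
    ∣ Y ∣ + ∣ X ─ Y ∣  ≤⟨ ∣p∣+∣q─p∣≤∣q∣ Y⊆X ⟩
    ∣ X ∣              ≤⟨ X-indep ⟩
    r X                ≤⟨ monotone X (Y ∪ (X ─ Y)) X⊆ ⟩
    r (Y ∪ (X ─ Y))    ≤⟨ subadditive Y (X ─ Y) ⟩
    r Y + r (X ─ Y)    ≤⟨ +-monoʳ-≤ (r Y) (bounded (X ─ Y)) ⟩
    r Y + ∣ X ─ Y ∣    ∎)
    where
    X⊆ : X ⊆ Y ∪ (X ─ Y)
    X⊆ {x} x∈X with x ∈? Y
    ... | yes x∈Y = x∈p∪q⁺ (inj₁ x∈Y)
    ... | no  x∉Y = x∈p∪q⁺ {p = Y} (inj₂ (x∈p∧x∉q⇒x∈p─q x∈X x∉Y))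

  -- The last element of a circuit lies in the closure of the others: `X ∩ C` contains the
  -- independent set `C - e`, whose size is at least `r C`, and submodularity of `X` and `C` does
  -- the rest.
  circuit-closure : ∀ {C X e} → IsCircuit r C → e ∈ₛ C → C - e ⊆ X → r (X ∪ C) ≤ r X
  circuit-closure {C} {X} {e} (C-dep , C-min) e∈C C-e⊆X = +-cancelʳ-≤ (r C) _ _ (begin
    r (X ∪ C) + r C        ≤⟨ +-monoʳ-≤ (r (X ∪ C)) rC≤ ⟩
    r (X ∪ C) + r (X ∩ C)  ≤⟨ submodular X C ⟩
    r X + r C              ∎)
    where
    rC≤ : r C ≤ r (X ∩ C)
    rC≤ = begin
      r C        ≤⟨ ≤-pred (≤-trans (≤∧≢⇒< (bounded C) C-dep) (≤-reflexive (sym (x∈p⇒1+∣p-x∣≡∣p∣ e∈C)))) ⟩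
      ∣ C - e ∣  ≡⟨ sym (C-min (C - e) (x∈p⇒p-x⊂p e∈C)) ⟩
      r (C - e)  ≤⟨ monotone _ _ (λ x∈ → x∈p∩q⁺ (C-e⊆X x∈ , p─q⊆p C ⁅ e ⁆ x∈)) ⟩
      r (X ∩ C)  ∎

-- Changing the rank of a single set.

infixl 30 _[_↦_]

_[_↦_] : ∀ {m} → RankFn m → Subset m → ℕ → RankFn m
(r [ T ↦ v ]) X with X ≟ₛ T
... | yes _ = v
... | no  _ = r X

module _ {m} {r : RankFn m} {T : Subset m} {v : ℕ} where

  ↦-hit : (r [ T ↦ v ]) T ≡ v
  ↦-hit with T ≟ₛ T
  ... | yes _ = refl
  ... | no ¬p = contradiction refl ¬p

  ↦-miss : ∀ {X} → X ≢ T → (r [ T ↦ v ]) X ≡ r X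
  ↦-miss {X} X≢T with X ≟ₛ T
  ... | yes p = contradiction p X≢T
  ... | no  _ = refl

  ↦-elim : (P : Subset m → ℕ → Set) → P T v → (∀ X → X ≢ T → P X (r X)) → ∀ X → P X ((r [ T ↦ v ]) X)
  ↦-elim P hit miss X with X ≟ₛ T
  ... | yes refl = hit
  ... | no  X≢T  = miss X X≢T

-- If every single-element exchange of T is a basis, then T may be declared a basis or a
-- circuit-hyperplane at will: this covers relaxing and its inverse.
module Redefine {m} {r : RankFn m} (M : IsMatroid r) {T : Subset m}
  (r⊤≤∣T∣ : r ⊤ ≤ ∣ T ∣)
  (e₀ : Fin m) (e₀∉T : e₀ ∉ₛ T)
  (exchanges : ∀ {k e} → k ∈ₛ T → e ∉ₛ T → ∣ T ∣ ≤ r (exchange T k e))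
  {v : ℕ} (v≤∣T∣ : v ≤ ∣ T ∣) (∣T∣≤1+v : ∣ T ∣ ≤ suc v) where

  open IsMatroid M
  open Matroid M
  open ≤-Reasoning

  private
    r′ = r [ T ↦ v ]

    exchange-indep : ∀ {k e} → k ∈ₛ T → e ∉ₛ T → ∣ exchange T k e ∣ ≤ r (exchange T k e)
    exchange-indep k∈T e∉T = ≤-trans (≤-reflexive (∣exchange∣ k∈T e∉T)) (exchanges k∈T e∉T)

    -- A proper subset of `T` misses some `k`, so it lies in the exchange of `k` for `e₀`, an
    -- independent set.
    subset-indep : ∀ {X} → X ⊆ T → X ≢ T → ∣ X ∣ ≤ r X
    subset-indep X⊆T X≢T with k , k∈T , k∉X ← ⊆∧≢⇒∃ X⊆T X≢T =
      full-rank-hereditary (exchange-indep k∈T e₀∉T)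
        λ x∈X → ∈exchange (X⊆T x∈X) λ { refl → k∉X x∈X }

    superset-spanning : ∀ {X} → T ⊆ X → T ≢ X → ∣ T ∣ ≤ r X
    superset-spanning {X} T⊆X T≢X with nonempty? T
    ... | no  T-empty = subst (λ Z → ∣ Z ∣ ≤ r X) (sym (Empty-unique T-empty))
                          (≤-trans (≤-reflexive (∣⊥∣≡0 m)) z≤n)
    ... | yes (k , k∈T) with e , e∈X , e∉T ← ⊆∧≢⇒∃ T⊆X T≢X =
      ≤-trans (exchanges k∈T e∉T) (monotone _ _ (exchange⊆ (T⊆X ∘ p─q⊆p T ⁅ k ⁆) e∈X))

    -- Adjoining to `T ∩ Y` an element of `Y` outside `T` stays inside an independent exchange, so
    -- `Y` gains at least one over `T ∩ Y`. This gain pays for a possible drop of one at `T`.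
    incomparable : ∀ {Y} → T ⊈ Y → Y ⊈ T → suc (r (T ∩ Y)) ≤ r Y
    incomparable {Y} T⊈Y Y⊈T
      with k , k∈T , k∉Y ← ⊈⇒∃ T⊈Y
         | e , e∈Y , e∉T ← ⊈⇒∃ Y⊈T = begin
      suc (r (T ∩ Y))      ≤⟨ s≤s (bounded (T ∩ Y)) ⟩
      suc ∣ T ∩ Y ∣        ≡⟨ sym (x∉p⇒∣p∪⁅x⁆∣≡1+∣p∣ (e∉T ∘ p∩q⊆p T Y)) ⟩
      ∣ (T ∩ Y) ∪ ⁅ e ⁆ ∣  ≤⟨ full-rank-hereditary (exchange-indep k∈T e∉T) (∪-least T∩Y⊆ (⁅⁆⊆ ∈exchange-new)) ⟩
      r ((T ∩ Y) ∪ ⁅ e ⁆)  ≤⟨ monotone _ _ (∪-least (p∩q⊆q T Y) (⁅⁆⊆ e∈Y)) ⟩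
      r Y                  ∎
      where
      T∩Y⊆ : T ∩ Y ⊆ exchange T k e
      T∩Y⊆ x∈ = ∈exchange (p∩q⊆p T Y x∈) λ { refl → k∉Y (p∩q⊆q T Y x∈) }

    r′≤∣T∣ : ∀ X → r′ X ≤ ∣ T ∣
    r′≤∣T∣ = ↦-elim (λ _ ρ → ρ ≤ ∣ T ∣) v≤∣T∣ λ X _ → ≤-trans (monotone X ⊤ ⊆⊤) r⊤≤∣T∣

    r′-bounded : ∀ X → r′ X ≤ ∣ X ∣
    r′-bounded = ↦-elim (λ X ρ → ρ ≤ ∣ X ∣) v≤∣T∣ λ X _ → bounded X

    r′-monotone : ∀ X Y → X ⊆ Y → r′ X ≤ r′ Y
    r′-monotone X Y X⊆Y with X ≟ₛ T | Y ≟ₛ T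
    ... | yes refl | yes _    = ≤-refl
    ... | yes refl | no Y≢T   = ≤-trans v≤∣T∣ (superset-spanning X⊆Y (Y≢T ∘ sym))
    -- A proper subset of `T` has at most `∣ T ∣ - 1` elements, hence at most `v`.
    ... | no X≢T   | yes refl = ≤-trans (bounded X)
      (≤-pred (≤-trans (p⊂q⇒∣p∣<∣q∣ (X⊆Y , ⊆∧≢⇒∃ X⊆Y X≢T)) ∣T∣≤1+v))
    ... | no _     | no _     = monotone X Y X⊆Y

    submodular-at-T : ∀ Y → r′ (T ∪ Y) + r′ (T ∩ Y) ≤ r′ T + r′ Y
    submodular-at-T Y with T ⊆? Y | Y ⊆? T
    ... | yes T⊆Y | _       = ≤-reflexive
      (trans (cong₂ (λ A B → r′ A + r′ B) T∪Y≡Y T∩Y≡T) (+-comm (r′ Y) (r′ T)))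
      where
      T∪Y≡Y : T ∪ Y ≡ Y
      T∪Y≡Y = ⊆-antisym (∪-least T⊆Y id) (q⊆p∪q T Y)
      T∩Y≡T : T ∩ Y ≡ T
      T∩Y≡T = ⊆-antisym (p∩q⊆p T Y) (λ x∈ → x∈p∩q⁺ (x∈ , T⊆Y x∈))
    ... | no _    | yes Y⊆T = ≤-reflexive (cong₂ (λ A B → r′ A + r′ B) T∪Y≡T T∩Y≡Y)
      where
      T∪Y≡T : T ∪ Y ≡ T
      T∪Y≡T = ⊆-antisym (∪-least id Y⊆T) (p⊆p∪q Y)
      T∩Y≡Y : T ∩ Y ≡ Y
      T∩Y≡Y = ⊆-antisym (p∩q⊆q T Y) (λ x∈ → x∈p∩q⁺ (Y⊆T x∈ , x∈))
    ... | no T⊈Y  | no Y⊈T  = begin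
      r′ (T ∪ Y) + r′ (T ∩ Y)  ≡⟨ cong (r′ (T ∪ Y) +_) (↦-miss λ eq → T⊈Y (subst (_⊆ Y) eq (p∩q⊆q T Y))) ⟩
      r′ (T ∪ Y) + r (T ∩ Y)   ≤⟨ +-monoˡ-≤ _ (≤-trans (r′≤∣T∣ (T ∪ Y)) ∣T∣≤1+v) ⟩
      -- The union may exceed the new rank of `T` by one; the surplus unit moves to `r (T ∩ Y)`,
      -- where `incomparable` absorbs it.
      suc v + r (T ∩ Y)        ≡⟨ sym (+-suc v _) ⟩
      v + suc (r (T ∩ Y))      ≤⟨ +-monoʳ-≤ v (incomparable T⊈Y Y⊈T) ⟩
      v + r Y                  ≡⟨ cong₂ _+_ (sym (↦-hit {r = r} {T}))
                                              (sym (↦-miss λ eq → Y⊈T (⊆-reflexive eq))) ⟩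
      r′ T + r′ Y              ∎

    r′-submodular : ∀ X Y → r′ (X ∪ Y) + r′ (X ∩ Y) ≤ r′ X + r′ Y
    r′-submodular X Y = case-X (X ≟ₛ T) (Y ≟ₛ T)
      where
      -- If the union is `T`, both sets are independent and the claim reduces to counting elements.
      -- If the intersection is `T`, both have rank at least `∣ T ∣`, which bounds every value of
      -- `r′`.
      generic : X ≢ T → Y ≢ T → Dec (X ∪ Y ≡ T) → Dec (X ∩ Y ≡ T) →
                r′ (X ∪ Y) + r′ (X ∩ Y) ≤ r X + r Y
      generic X≢T Y≢T (yes ∪≡T) _ = begin
        r′ (X ∪ Y) + r′ (X ∩ Y)  ≤⟨ +-mono-≤ (r′-bounded (X ∪ Y)) (r′-bounded (X ∩ Y)) ⟩
        ∣ X ∪ Y ∣ + ∣ X ∩ Y ∣    ≡⟨ ∣p∪q∣+∣p∩q∣ X Y ⟩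
        ∣ X ∣ + ∣ Y ∣            ≤⟨ +-mono-≤ (subset-indep (subst (X ⊆_) ∪≡T (p⊆p∪q Y)) X≢T)
                                             (subset-indep (subst (Y ⊆_) ∪≡T (q⊆p∪q X Y)) Y≢T) ⟩
        r X + r Y                ∎
      generic X≢T Y≢T (no _) (yes ∩≡T) = begin
        r′ (X ∪ Y) + r′ (X ∩ Y)  ≤⟨ +-mono-≤ (r′≤∣T∣ (X ∪ Y)) (r′≤∣T∣ (X ∩ Y)) ⟩
        ∣ T ∣ + ∣ T ∣            ≤⟨ +-mono-≤ (superset-spanning (subst (_⊆ X) ∩≡T (p∩q⊆p X Y)) (X≢T ∘ sym))
                                             (superset-spanning (subst (_⊆ Y) ∩≡T (p∩q⊆q X Y)) (Y≢T ∘ sym)) ⟩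
        r X + r Y                ∎
      generic X≢T Y≢T (no ∪≢T) (no ∩≢T) = begin
        r′ (X ∪ Y) + r′ (X ∩ Y)  ≡⟨ cong₂ _+_ (↦-miss ∪≢T) (↦-miss ∩≢T) ⟩
        r (X ∪ Y) + r (X ∩ Y)    ≤⟨ submodular X Y ⟩
        r X + r Y                ∎

      case-X : Dec (X ≡ T) → Dec (Y ≡ T) → r′ (X ∪ Y) + r′ (X ∩ Y) ≤ r′ X + r′ Y
      case-X (yes refl) _          = submodular-at-T Y
      case-X (no _)     (yes refl) = begin
        r′ (X ∪ Y) + r′ (X ∩ Y)  ≡⟨ cong₂ (λ A B → r′ A + r′ B) (∪-comm X Y) (∩-comm X Y) ⟩
        r′ (Y ∪ X) + r′ (Y ∩ X)  ≤⟨ submodular-at-T X ⟩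
        r′ Y + r′ X              ≡⟨ +-comm (r′ Y) (r′ X) ⟩
        r′ X + r′ Y              ∎
      case-X (no X≢T)   (no Y≢T)   =
        ≤-trans (generic X≢T Y≢T (X ∪ Y ≟ₛ T) (X ∩ Y ≟ₛ T))
                (≤-reflexive (sym (cong₂ _+_ (↦-miss X≢T) (↦-miss Y≢T))))

  isMatroid : IsMatroid r′
  isMatroid = record { bounded = r′-bounded ; monotone = r′-monotone ; submodular = r′-submodular }

-- Induction on subsets and small facts about legs.

subset-induction : ∀ {m ℓ} (P : Subset m → Set ℓ) → P ⊥ → (∀ x p → P p → P (⁅ x ⁆ ∪ p)) → ∀ p → P p
subset-induction P base step []      = base
subset-induction P base step (s ∷ p) =
  extend s (subset-induction (P ∘ (outside ∷_)) base (λ x q → step (suc x) (outside ∷ q)) p)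
  where
  extend : ∀ s → P (outside ∷ p) → P (s ∷ p)
  extend outside Pp = Pp
  extend inside  Pp = subst (P ∘ (inside ∷_)) (∪-identityˡ p) (step zero (outside ∷ p) Pp)

xor-trueʳ : ∀ b → b xor true ≡ not b
xor-trueʳ false = refl
xor-trueʳ true  = refl

∣++∣ : ∀ {m n} (p : Subset m) (q : Subset n) → ∣ p ++ q ∣ ≡ ∣ p ∣ + ∣ q ∣
∣++∣ []            q = refl
∣++∣ (inside  ∷ p) q = cong suc (∣++∣ p q)
∣++∣ (outside ∷ p) q = ∣++∣ p q

∣⁅x⁆∪⁅y⁆∣≡2 : ∀ {n} {x y : Fin n} → x ≢ y → ∣ ⁅ x ⁆ ∪ ⁅ y ⁆ ∣ ≡ 2
∣⁅x⁆∪⁅y⁆∣≡2 {x = x} x≢y =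
  trans (x∉p⇒∣p∪⁅x⁆∣≡1+∣p∣ (x≢y ∘ sym ∘ x∈⁅y⁆⇒x≡y x)) (cong suc (∣⁅x⁆∣≡1 x))

other : ∀ {n} → 3 ≤ n → (i j : Fin n) → ∃[ k ] k ≢ i × k ≢ j
other (s≤s (s≤s (s≤s _))) zero          zero          = suc zero , (λ ()) , (λ ())
other (s≤s (s≤s (s≤s _))) zero          (suc zero)    = suc (suc zero) , (λ ()) , (λ ())
other (s≤s (s≤s (s≤s _))) zero          (suc (suc _)) = suc zero , (λ ()) , (λ ())
other (s≤s (s≤s (s≤s _))) (suc zero)    zero          = suc (suc zero) , (λ ()) , (λ ())
other (s≤s (s≤s (s≤s _))) (suc (suc _)) zero          = suc zero , (λ ()) , (λ ())
other (s≤s (s≤s (s≤s _))) (suc _)       (suc _)       = zero , (λ ()) , (λ ())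

-- Legs and transversals of a spike.

module Ground (n : ℕ) where

  infixl 6 _⊕_

  -- el i false and el i true are the paper's a_i and b_i; transversal S contains b_i for i ∈ S
  -- and a_i for i ∉ S.
  opaque
    el : Fin n → Bool → Fin (n + n)
    el i false = i ↑ˡ n
    el i true  = n ↑ʳ i

    transversal : Subset n → Subset (n + n)
    transversal S = ∁ S ++ S

    _⊕_ : Subset n → Subset n → Subset n
    _⊕_ = zipWith _xor_

    lookup-⊕ : ∀ S D i → lookup (S ⊕ D) i ≡ lookup S i xor lookup D i
    lookup-⊕ S D i = lookup-zipWith _xor_ i S D

    el-cases : ∀ e → ∃₂ λ i β → el i β ≡ e
    el-cases e with splitAt n e in eq
    ... | inj₁ i = i , false , splitAt⁻¹-↑ˡ eq
    ... | inj₂ i = i , true  , splitAt⁻¹-↑ʳ {n} eq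

    lookup-legs : ∀ (J : Subset n) i β → lookup (legs J) (el i β) ≡ lookup J i
    lookup-legs J i false = lookup-++ˡ J J i
    lookup-legs J i true  = lookup-++ʳ J J i

    lookup-transversal : ∀ S i β → lookup (transversal S) (el i β) ≡ not (lookup S i xor β)
    lookup-transversal S i false = begin
      lookup (∁ S ++ S) (i ↑ˡ n)  ≡⟨ lookup-++ˡ (∁ S) S i ⟩
      lookup (∁ S) i              ≡⟨ lookup-map i not S ⟩
      not (lookup S i)            ≡⟨ cong not (sym (xor-identityʳ (lookup S i))) ⟩
      not (lookup S i xor false)  ∎
      where open ≡-Reasoning
    lookup-transversal S i true  = begin
      lookup (∁ S ++ S) (n ↑ʳ i)  ≡⟨ lookup-++ʳ (∁ S) S i ⟩
      lookup S i                  ≡⟨ sym (not-involutive (lookup S i)) ⟩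
      not (not (lookup S i))      ≡⟨ cong not (sym (xor-trueʳ (lookup S i))) ⟩
      not (lookup S i xor true)   ∎
      where open ≡-Reasoning

    ∣transversal∣ : ∀ S → ∣ transversal S ∣ ≡ n
    ∣transversal∣ S = begin
      ∣ ∁ S ++ S ∣         ≡⟨ ∣++∣ (∁ S) S ⟩
      ∣ ∁ S ∣ + ∣ S ∣      ≡⟨ cong (_+ ∣ S ∣) (∣∁p∣≡n∸∣p∣ S) ⟩
      n ∸ ∣ S ∣ + ∣ S ∣    ≡⟨ m∸n+n≡m (∣p∣≤n S) ⟩
      n                    ∎
      where open ≡-Reasoning

    drop-transversal : ∀ S → drop n (transversal S) ≡ S
    drop-transversal S = ++-injectiveʳ (take n (transversal S)) (∁ S) (take++drop≡id n (transversal S))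

    ⊕-identityʳ : ∀ S → S ⊕ ⊥ ≡ S
    ⊕-identityʳ = zipWith-identityʳ xor-identityʳ

    ⊕-cancelʳ : ∀ S D → (S ⊕ D) ⊕ D ≡ S
    ⊕-cancelʳ S D = begin
      (S ⊕ D) ⊕ D  ≡⟨ zipWith-assoc xor-assoc S D D ⟩
      S ⊕ (D ⊕ D)  ≡⟨ cong (S ⊕_) (⊕-self D) ⟩
      S ⊕ ⊥        ≡⟨ ⊕-identityʳ S ⟩
      S            ∎
      where
      open ≡-Reasoning
      ⊕-self : ∀ {m} (p : Subset m) → zipWith _xor_ p p ≡ ⊥
      ⊕-self []      = refl
      ⊕-self (s ∷ p) = cong₂ _∷_ (xor-same s) (⊕-self p)

  -- Matching on a view names the leg and the side of a ground element, which its position in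
  -- `Fin (n + n)` hides.
  data View : Fin (n + n) → Set where
    ⟨_,_⟩ : ∀ i β → View (el i β)

  view : ∀ e → View e
  view e with i , β , refl ← el-cases e = ⟨ i , β ⟩

  el∈legs⁺ : ∀ J {i} β → i ∈ₛ J → el i β ∈ₛ legs J
  el∈legs⁺ J {i} β i∈J = lookup⇒[]= (el i β) (legs J) (trans (lookup-legs J i β) ([]=⇒lookup i∈J))

  el∈legs⁻ : ∀ J {i β} → el i β ∈ₛ legs J → i ∈ₛ J
  el∈legs⁻ J {i} {β} e∈ = lookup⇒[]= i J (trans (sym (lookup-legs J i β)) ([]=⇒lookup e∈))

  el∈transversal⁺ : ∀ {S i β} → lookup S i ≡ β → el i β ∈ₛ transversal S
  el∈transversal⁺ {S} {i} {β} refl = lookup⇒[]= (el i β) (transversal S)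
    (trans (lookup-transversal S i β) (cong not (xor-same β)))

  el∈transversal⁻ : ∀ {S i β} → el i β ∈ₛ transversal S → lookup S i ≡ β
  el∈transversal⁻ {S} {i} {β} e∈ =
    not-xor⁻ (lookup S i) β (trans (sym (lookup-transversal S i β)) ([]=⇒lookup e∈))
    where
    not-xor⁻ : ∀ b c → not (b xor c) ≡ true → b ≡ c
    not-xor⁻ false false _ = refl
    not-xor⁻ true  true  _ = refl

  ∈leg⇒≡ : ∀ i {j β} → el j β ∈ₛ legs ⁅ i ⁆ → j ≡ i
  ∈leg⇒≡ i e∈ = x∈⁅y⁆⇒x≡y i (el∈legs⁻ ⁅ i ⁆ e∈)

  el-injectiveˡ : ∀ {i j} β γ → el i β ≡ el j γ → i ≡ j
  el-injectiveˡ {i} {j} β γ eq = ∈leg⇒≡ j (subst (_∈ₛ legs ⁅ j ⁆) (sym eq) (el∈legs⁺ ⁅ j ⁆ γ (x∈⁅x⁆ j)))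

  el-other∉transversal : ∀ {S} i → el i (not (lookup S i)) ∉ₛ transversal S
  el-other∉transversal i e∈ = not-¬ refl (el∈transversal⁻ e∈)

  el∉transversal⇒other : ∀ {S} {i} β → el i β ∉ₛ transversal S → β ≡ not (lookup S i)
  el∉transversal⇒other β e∉ = ¬-not (e∉ ∘ el∈transversal⁺ ∘ sym)

  leg⊈transversal : ∀ {S} {X} i → (∀ β → el i β ∈ₛ X) → X ≢ transversal S
  leg⊈transversal {S} i leg⊆X refl = el-other∉transversal {S} i (leg⊆X _)

  lookup-⊕-∈ : ∀ {S D i} → i ∈ₛ D → lookup (S ⊕ D) i ≡ not (lookup S i)
  lookup-⊕-∈ {S} {D} {i} i∈D = trans (lookup-⊕ S D i)
    (trans (cong (lookup S i xor_) ([]=⇒lookup i∈D)) (xor-trueʳ (lookup S i)))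

  lookup-⊕-∉ : ∀ {S D i} → i ∉ₛ D → lookup (S ⊕ D) i ≡ lookup S i
  lookup-⊕-∉ {S} {D} {i} i∉D = trans (lookup-⊕ S D i)
    (trans (cong (lookup S i xor_) (¬-not {lookup D i} {true} (i∉D ∘ lookup⇒[]= i D)))
           (xor-identityʳ (lookup S i)))

  -- For `k ≢ i` this set has both elements of leg `i`, none of leg `k` and one of every other leg;
  -- for `k ≡ i` it is the transversal switched at leg `i`.
  crossExchange : Subset n → Fin n → Fin n → Subset (n + n)
  crossExchange S k i = exchange (transversal S) (el k (lookup S k)) (el i (not (lookup S i)))

  -- The rank bounds of a spike on which the linear algebra rests. Each set in them contains a whole
  -- leg, unlike any transversal, so the bounds survive a redefinition at a transversal.
  record LegRanks (r : RankFn (n + n)) : Set where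
    field
      rank≤n    : r ⊤ ≤ n
      two-legs  : ∀ {i j} → i ≢ j → r (legs {n} (⁅ i ⁆ ∪ ⁅ j ⁆)) ≤ 3
      cross     : ∀ S {k i} → k ≢ i → n ≤ r (crossExchange S k i)

  module _ {S : Subset n} {k i : Fin n} where

    ∣crossExchange∣ : ∣ crossExchange S k i ∣ ≡ n
    ∣crossExchange∣ =
      trans (∣exchange∣ {p = transversal S} (el∈transversal⁺ refl) (el-other∉transversal {S} i))
            (∣transversal∣ S)

    el∈crossExchange : ∀ {j} → j ≢ k → el j (lookup S j) ∈ₛ crossExchange S k i
    el∈crossExchange j≢k = ∈exchange (el∈transversal⁺ refl) (j≢k ∘ el-injectiveˡ _ _)

    leg⊆crossExchange : k ≢ i → ∀ β → el i β ∈ₛ crossExchange S k i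
    leg⊆crossExchange k≢i β with β Bool.≟ lookup S i
    ... | yes refl = el∈crossExchange (k≢i ∘ sym)
    ... | no  β≢   = subst (λ γ → el i γ ∈ₛ crossExchange S k i) (sym (¬-not β≢))
                       (∈exchange-new)

  LegRanks-redefine : ∀ {r} → 3 ≤ n → LegRanks r → (S : Subset n) (v : ℕ) →
                      LegRanks (r [ transversal S ↦ v ])
  LegRanks-redefine {r} 3≤n@(s≤s _) L S v = record
    { rank≤n   = subst (_≤ n) (sym (miss ⊤ zero (λ _ → ∈⊤))) rank≤n
    ; two-legs = λ {i} {j} i≢j → subst (_≤ 3)
        (sym (miss (legs (⁅ i ⁆ ∪ ⁅ j ⁆)) i λ β → el∈legs⁺ (⁅ i ⁆ ∪ ⁅ j ⁆) β (p⊆p∪q ⁅ j ⁆ (x∈⁅x⁆ i))))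
        (two-legs i≢j)
    ; cross    = λ S′ {k} {i} k≢i → subst (n ≤_)
        (sym (miss (crossExchange S′ k i) i (leg⊆crossExchange {S = S′} k≢i)))
        (cross S′ k≢i)
    }
    where
    open LegRanks L
    miss : ∀ X i → (∀ β → el i β ∈ₛ X) → (r [ transversal S ↦ v ]) X ≡ r X
    miss X i leg⊆X = ↦-miss (leg⊈transversal i leg⊆X)

  -- Rank bounds derived from the tip.

  module Spike {r} (isSpike : IsSpike n r) where

    private
      3≤n = proj₁ isSpike
      rN = proj₁ (proj₂ isSpike)
      extension = proj₁ (proj₂ (proj₂ isSpike))
      N-isMatroid = proj₁ extension
      rank-N = proj₁ (proj₂ extension)
      triangles = proj₁ (proj₂ (proj₂ extension))
      leg-unions = proj₂ (proj₂ (proj₂ extension))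
      r≡rN = proj₂ (proj₂ (proj₂ isSpike))
      module N  = IsMatroid N-isMatroid
      module N′ = Matroid N-isMatroid

    isMatroid : IsMatroid r
    isMatroid = record
      { bounded    = λ X → subst (_≤ ∣ X ∣) (sym (r≡rN X)) (N.bounded (outside ∷ X))
      ; monotone   = λ X Y X⊆Y → subst₂ _≤_ (sym (r≡rN X)) (sym (r≡rN Y)) (N.monotone _ _ (out⊆ X⊆Y))
      ; submodular = λ X Y → subst₂ _≤_ (sym (cong₂ _+_ (r≡rN (X ∪ Y)) (r≡rN (X ∩ Y))))
                                        (sym (cong₂ _+_ (r≡rN X) (r≡rN Y)))
                                        (N.submodular (outside ∷ X) (outside ∷ Y))
      }

    rank-legs : ∀ {J : Subset n} → Nonempty J → ProperSubset J → r (legs J) ≡ ∣ J ∣ + 1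
    rank-legs J≢∅ J≢⊤ = trans (r≡rN _) (leg-unions _ J≢∅ J≢⊤)

    -- Leg i puts the tip in the closure of the exchanged set; the tip together with one
    -- element of a leg other than k yields the rest of that leg.
    private
      module _ (S : Subset n) {k i : Fin n} (k≢i : k ≢ i) where
        open ≤-Reasoning

        tip-legs : Subset n → Subset (suc (n + n))
        tip-legs J = inside ∷ legs J

        tip-leg : Fin n → Subset (suc (n + n))
        tip-leg j = tip-legs ⁅ j ⁆

        X X₁ : Subset (suc (n + n))
        X  = outside ∷ crossExchange S k i
        X₁ = X ∪ tip-leg i

        rX₁≤rX : rN X₁ ≤ rN X
        rX₁≤rX = N′.circuit-closure (triangles i) here C-t⊆X
          where
          C-t⊆X : tip-leg i - zero ⊆ X
          C-t⊆X {suc e} (there e∈) with view e | p─q⊆p (legs ⁅ i ⁆) ⊥ e∈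
          ... | ⟨ j , β ⟩ | e∈leg with refl ← ∈leg⇒≡ i e∈leg =
            there (leg⊆crossExchange {S = S} k≢i β)

        rX₁∪legs≤rX₁ : ∀ L → L ⊆ ⊤ - k → rN (X₁ ∪ tip-legs L) ≤ rN X₁
        rX₁∪legs≤rX₁ = subset-induction _ base step
          where
          base : ⊥ ⊆ ⊤ - k → rN (X₁ ∪ tip-legs ⊥) ≤ rN X₁
          -- `tip-legs ⊥` is the tip alone, which `X₁` already contains.
          base _ = N.monotone _ _ (∪-least {p = X₁} {tip-legs ⊥} id λ
            { here              → q⊆p∪q X (tip-leg i) here
            ; (there {i = e} e∈) → contradiction e∈ (e∉ e) })
            where
            e∉ : ∀ e → e ∉ₛ legs {n} ⊥
            e∉ e e∈ with ⟨ j , β ⟩ ← view e = contradiction (el∈legs⁻ ⊥ e∈) ∉⊥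
          step : ∀ l L → (L ⊆ ⊤ - k → rN (X₁ ∪ tip-legs L) ≤ rN X₁) →
                 ⁅ l ⁆ ∪ L ⊆ ⊤ - k → rN (X₁ ∪ tip-legs (⁅ l ⁆ ∪ L)) ≤ rN X₁
          step l L ih l∪L⊆ = begin
            rN (X₁ ∪ tip-legs (⁅ l ⁆ ∪ L))         ≤⟨ N.monotone _ _ incl ⟩
            rN (X₂ ∪ C)                            ≤⟨ N′.circuit-closure (triangles l)
                                                        (there (el∈legs⁺ ⁅ l ⁆ _ (x∈⁅x⁆ l))) C-e⊆X₂ ⟩
            rN X₂                                  ≤⟨ ih (λ x∈ → l∪L⊆ (q⊆p∪q ⁅ l ⁆ L x∈)) ⟩
            rN X₁                                  ∎
            where
            X₂ = X₁ ∪ tip-legs L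
            C  = tip-leg l
            l≢k : l ≢ k
            l≢k refl = x∉p-x {p = ⊤} (l∪L⊆ (p⊆p∪q L (x∈⁅x⁆ l)))
            incl : X₁ ∪ tip-legs (⁅ l ⁆ ∪ L) ⊆ X₂ ∪ C
            incl = ∪-least {p = X₁} {tip-legs (⁅ l ⁆ ∪ L)} (p⊆p∪q C ∘ p⊆p∪q (tip-legs L)) λ
              { here               → q⊆p∪q X₂ C here
              ; (there {i = e} e∈) → split e e∈ }
              where
              split : ∀ e → e ∈ₛ legs (⁅ l ⁆ ∪ L) → suc e ∈ₛ X₂ ∪ C
              split e e∈ with view e
              ... | ⟨ j , β ⟩ with x∈p∪q⁻ ⁅ l ⁆ L (el∈legs⁻ (⁅ l ⁆ ∪ L) e∈)
              ...   | inj₁ j∈l = q⊆p∪q X₂ C (there (el∈legs⁺ ⁅ l ⁆ β j∈l))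
              ...   | inj₂ j∈L = p⊆p∪q C (q⊆p∪q X₁ (tip-legs L) (there (el∈legs⁺ L β j∈L)))
            -- Of the triangle on leg `l`, the tip and the element chosen by `S` are already
            -- present; the latter because `l ≢ k`.
            C-e⊆X₂ : C - suc (el l (not (lookup S l))) ⊆ X₂
            C-e⊆X₂ {zero}  _  = q⊆p∪q X₁ (tip-legs L) here
            C-e⊆X₂ {suc e} (there e∈) with view e
            ... | ⟨ j , β ⟩ with refl ← ∈leg⇒≡ l (p─q⊆p (legs ⁅ l ⁆) _ e∈) | β Bool.≟ lookup S l
            ...   | yes refl = p⊆p∪q {p = X₁} (tip-legs L)
                                 (p⊆p∪q {p = X} (tip-leg i) (there (el∈crossExchange {S = S} l≢k)))
            ...   | no β≢ with refl ← ¬-not β≢ = contradiction e∈ x∉p-x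

        rank-cross : n ≤ r (crossExchange S k i)
        rank-cross = begin
          n                                    ≡⟨ sym (∣⊤∣≡n n) ⟩
          ∣ ⊤ {n} ∣                            ≡⟨ sym (x∈p⇒1+∣p-x∣≡∣p∣ {x = k} ∈⊤) ⟩
          suc ∣ ⊤ - k ∣                        ≡⟨ +-comm 1 _ ⟩
          -- All legs but `k` together have rank `(n - 1) + 1`, that is, full rank.
          ∣ ⊤ - k ∣ + 1                        ≡⟨ sym (leg-unions (⊤ - k) (i , x∈p∧x≢y⇒x∈p-y ∈⊤ (k≢i ∘ sym))
                                                    λ eq → x∉p-x (subst (k ∈ₛ_) (sym eq) ∈⊤)) ⟩
          rN (outside ∷ legs (⊤ - k))          ≤⟨ N.monotone _ _ (q⊆p∪q X₁ (tip-legs (⊤ - k)) ∘ out⊆ id) ⟩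
          rN (X₁ ∪ tip-legs (⊤ - k))           ≤⟨ rX₁∪legs≤rX₁ (⊤ - k) id ⟩
          rN X₁                                ≤⟨ rX₁≤rX ⟩
          rN X                                 ≡⟨ sym (r≡rN _) ⟩
          r (crossExchange S k i)              ∎

    legRanks : LegRanks r
    legRanks = record
      { rank≤n   = subst₂ _≤_ (sym (r≡rN ⊤)) rank-N (N.monotone _ _ ⊆⊤)
      ; two-legs = λ {i} {j} i≢j → ≤-reflexive
          (trans (rank-legs {⁅ i ⁆ ∪ ⁅ j ⁆} (i , p⊆p∪q ⁅ j ⁆ (x∈⁅x⁆ i)) (pair≢⊤ i j))
                 (cong (_+ 1) (∣⁅x⁆∪⁅y⁆∣≡2 i≢j)))
      ; cross    = rank-cross
      }
      where
      pair≢⊤ : ∀ i j → ⁅ i ⁆ ∪ ⁅ j ⁆ ≢ ⊤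
      pair≢⊤ i j eq with k , k≢i , k≢j ← other 3≤n i j =
        [ k≢i ∘ x∈⁅y⁆⇒x≡y i , k≢j ∘ x∈⁅y⁆⇒x≡y j ]′ (x∈p∪q⁻ ⁅ i ⁆ ⁅ j ⁆ (subst (k ∈ₛ_) (sym eq) ∈⊤))

  -- Neighbouring transversals.

  module _ {r} (3≤n : 3 ≤ n) (M : IsMatroid r) (L : LegRanks r) where
    open IsMatroid M
    open Matroid M
    open LegRanks L
    open ≤-Reasoning

    -- An exchange between two legs is a cross exchange and always spans; an exchange within one leg
    -- is a neighbouring transversal.
    exchanges-spanning : ∀ {S} → (∀ i → n ≤ r (transversal (S ⊕ ⁅ i ⁆))) →
                         ∀ {k e} → k ∈ₛ transversal S → e ∉ₛ transversal S →
                         n ≤ r (exchange (transversal S) k e)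
    exchanges-spanning {S} neighbours {k} {e} k∈ e∉ with view k | view e
    ... | ⟨ k , β ⟩ | ⟨ i , γ ⟩
      with refl ← el∈transversal⁻ k∈ | refl ← el∉transversal⇒other γ e∉ | k Fin.≟ i
    ...   | no k≢i   = cross S k≢i
    ...   | yes refl = ≤-trans (neighbours i) (monotone _ _ λ {e} → incl e)
      where
      incl : ∀ e → e ∈ₛ transversal (S ⊕ ⁅ i ⁆) → e ∈ₛ crossExchange S i i
      incl e e∈ with view e
      ... | ⟨ j , δ ⟩ with j Fin.≟ i | el∈transversal⁻ e∈
      ...   | yes refl | refl rewrite lookup-⊕-∈ {S = S} (x∈⁅x⁆ i)     = ∈exchange-new
      ...   | no  j≢i  | refl rewrite lookup-⊕-∉ {S = S} (x≢y⇒x∉⁅y⁆ j≢i) = el∈crossExchange {S = S} j≢i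

    -- The union of a transversal and its neighbour contains a cross exchange, so it has rank at
    -- least `n`; their intersection has rank at least `n - 1`, being all of the transversal but one
    -- element. By submodularity the two ranks sum to at least `2n - 1`, so at most one of them is
    -- below `n`.
    neighbour-spanning : ∀ {S} → r (transversal S) < n → ∀ i → n ≤ r (transversal (S ⊕ ⁅ i ⁆))
    neighbour-spanning {S} dep i = ≤-pred (+-cancelˡ-≤ ∣ A - eᵢ ∣ _ _ (begin
      ∣ A - eᵢ ∣ + suc n            ≡⟨ +-suc ∣ A - eᵢ ∣ n ⟩
      suc ∣ A - eᵢ ∣ + n            ≡⟨ cong (_+ n) size ⟩
      n + n                         ≤⟨ +-mono-≤ n≤r∪ n≤1+r∩ ⟩
      r (A ∪ B) + suc (r (A ∩ B))   ≡⟨ +-suc _ _ ⟩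
      suc (r (A ∪ B) + r (A ∩ B))   ≤⟨ s≤s (submodular A B) ⟩
      suc (r A + r B)               ≤⟨ +-monoˡ-≤ (r B) dep ⟩
      n + r B                       ≡⟨ cong (_+ r B) (sym size) ⟩
      suc ∣ A - eᵢ ∣ + r B          ≡⟨ sym (+-suc ∣ A - eᵢ ∣ (r B)) ⟩
      ∣ A - eᵢ ∣ + suc (r B)        ∎))
      where
      A = transversal S
      B = transversal (S ⊕ ⁅ i ⁆)
      eᵢ = el i (lookup S i)

      size : suc ∣ A - eᵢ ∣ ≡ n
      size = trans (x∈p⇒1+∣p-x∣≡∣p∣ (el∈transversal⁺ {S = S} refl)) (∣transversal∣ S)

      n≤r∪ : n ≤ r (A ∪ B)
      n≤r∪ with k , k≢i , _ ← other 3≤n i i = ≤-trans (cross S k≢i) (monotone _ _ (exchange⊆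
        (p⊆p∪q B ∘ p─q⊆p A _) (q⊆p∪q A B (el∈transversal⁺ (lookup-⊕-∈ {S = S} (x∈⁅x⁆ i))))))

      A-eᵢ⊆B : ∀ e → e ∈ₛ A - eᵢ → e ∈ₛ B
      A-eᵢ⊆B e e∈ with view e
      ... | ⟨ j , β ⟩ with j Fin.≟ i | el∈transversal⁻ (p─q⊆p A _ e∈)
      ...   | yes refl | refl = contradiction e∈ x∉p-x
      ...   | no  j≢i  | refl = el∈transversal⁺ (lookup-⊕-∉ {S = S} (x≢y⇒x∉⁅y⁆ j≢i))

      n≤1+r∩ : n ≤ suc (r (A ∩ B))
      -- Here leg `i` is the one emptied and leg `k` the one filled, so the cross exchange contains
      -- `A - eᵢ`.
      n≤1+r∩ with k , k≢i , _ ← other 3≤n i i = begin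
        n                   ≡⟨ sym size ⟩
        suc ∣ A - eᵢ ∣      ≤⟨ s≤s (full-rank-hereditary
                                       (≤-trans (≤-reflexive (∣crossExchange∣ {S = S})) (cross S (k≢i ∘ sym)))
                                       p-k⊆exchange) ⟩
        suc (r (A - eᵢ))    ≤⟨ s≤s (monotone _ _ λ {e} e∈ → x∈p∩q⁺ (p─q⊆p A _ e∈ , A-eᵢ⊆B e e∈)) ⟩
        suc (r (A ∩ B))     ∎

-- Linear algebra over a finite field.

anyVec? : ∀ {q m} {P : Vec (Fin q) m → Set} → Decidable P → Dec (∃ P)
anyVec? {m = zero}  P? = map′ ([] ,_) (λ { ([] , p) → p }) (P? [])
anyVec? {m = suc m} P? = map′ (λ (x , xs , p) → x ∷ xs , p) (λ { (x ∷ xs , p) → x , xs , p })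
  (any? λ x → anyVec? λ xs → P? (x ∷ xs))

module FiniteField {q} (F : CommutativeRing 0ℓ 0ℓ) (isField : IsField F) (hasOrder : HasOrder F q) where

  open CommutativeRing F using (Carrier; _≈_; 0#; 1#; setoid)
    renaming (_+_ to _⊹_; _*_ to _·_; -_ to ⊖_)
  private module F = CommutativeRing F
  open IsField isField
  open RingProperties F.ring using (-‿distribˡ-*)
  open import Relation.Binary.Reasoning.Setoid setoid
  open SemiringSum F.semiring
    using (sum; sum-cong-≋; sum-remove; ∑-distrib-+; sum-replicate-zero; *-distribˡ-sum)

  index : Carrier → Fin q
  index x = proj₁ (proj₂ (proj₂ hasOrder) x)

  element : Fin q → Carrier
  element = proj₁ hasOrder

  element-index : ∀ x → element (index x) ≈ x
  element-index x = proj₂ (proj₂ (proj₂ hasOrder) x)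

  index-injective : ∀ {x y} → index x ≡ index y → x ≈ y
  index-injective {x} {y} eq =
    F.trans (F.sym (element-index x)) (F.trans (F.reflexive (cong element eq)) (element-index y))

  infix 4 _≈?_

  _≈?_ : ∀ x y → Dec (x ≈ y)
  x ≈? y = map′ index-injective (λ x≈y → proj₁ (proj₂ hasOrder) _ _
    (F.trans (element-index x) (F.trans x≈y (F.sym (element-index y))))) (index x Fin.≟ index y)

  x·z≈0⇒x≈0 : ∀ {x z} → ¬ z ≈ 0# → x · z ≈ 0# → x ≈ 0#
  x·z≈0⇒x≈0 {x} {z} z≉0 xz≈0 with z⁻¹ , zz⁻¹≈1 ← inverse z z≉0 = begin
    x                ≈⟨ F.*-identityʳ x ⟨
    x · 1#           ≈⟨ F.*-congˡ zz⁻¹≈1 ⟨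
    x · (z · z⁻¹)    ≈⟨ F.*-assoc x z z⁻¹ ⟨
    (x · z) · z⁻¹    ≈⟨ F.*-congʳ xz≈0 ⟩
    0# · z⁻¹         ≈⟨ F.zeroˡ z⁻¹ ⟩
    0#               ∎

  cancel : ∀ x {y} → ¬ y ≈ 0# → ∃[ s ] x ⊹ s · y ≈ 0#
  cancel x {y} y≉0 with y⁻¹ , yy⁻¹≈1 ← inverse y y≉0 = ⊖ (x · y⁻¹) , (begin
    x ⊹ (⊖ (x · y⁻¹)) · y     ≈⟨ F.+-congˡ (-‿distribˡ-* (x · y⁻¹) y) ⟨
    x ⊹ ⊖ ((x · y⁻¹) · y)     ≈⟨ F.+-congˡ (F.-‿cong (F.*-assoc x y⁻¹ y)) ⟩
    x ⊹ ⊖ (x · (y⁻¹ · y))     ≈⟨ F.+-congˡ (F.-‿cong (F.*-congˡ (F.*-comm y⁻¹ y))) ⟩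
    x ⊹ ⊖ (x · (y · y⁻¹))     ≈⟨ F.+-congˡ (F.-‿cong (F.*-congˡ yy⁻¹≈1)) ⟩
    x ⊹ ⊖ (x · 1#)            ≈⟨ F.+-congˡ (F.-‿cong (F.*-identityʳ x)) ⟩
    x ⊹ ⊖ x                   ≈⟨ F.-‿inverseʳ x ⟩
    0#                        ∎)

  x≈0⇒x⊹y≈y : ∀ {x y} → x ≈ 0# → x ⊹ y ≈ y
  x≈0⇒x⊹y≈y {y = y} x≈0 = F.trans (F.+-congʳ x≈0) (F.+-identityˡ y)

  y≈0⇒x⊹y≈x : ∀ {x y} → y ≈ 0# → x ⊹ y ≈ x
  y≈0⇒x⊹y≈x {x} y≈0 = F.trans (F.+-congˡ y≈0) (F.+-identityʳ x)

  y≈0⇒x·y≈0 : ∀ {x y} → y ≈ 0# → x · y ≈ 0#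
  y≈0⇒x·y≈0 {x} y≈0 = F.trans (F.*-congˡ y≈0) (F.zeroʳ x)

  ∑≡sum : ∀ {n} (g : Fin n → Carrier) → ∑ F g ≡ sum g
  ∑≡sum {zero}  g = refl
  ∑≡sum {suc n} g = cong (g zero ⊹_) (∑≡sum (g ∘ suc))

  ∑-cong : ∀ {n} {f g : Fin n → Carrier} → (∀ i → f i ≈ g i) → ∑ F f ≈ ∑ F g
  ∑-cong {f = f} {g} f≈g rewrite ∑≡sum f | ∑≡sum g = sum-cong-≋ f≈g

  ∑-zero : ∀ {n} {f : Fin n → Carrier} → (∀ i → f i ≈ 0#) → ∑ F f ≈ 0#
  ∑-zero {n} {f} f≈0 rewrite ∑≡sum f = F.trans (sum-cong-≋ f≈0) (sum-replicate-zero n)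

  ∑-+ : ∀ {n} (f g : Fin n → Carrier) → ∑ F (λ i → f i ⊹ g i) ≈ ∑ F f ⊹ ∑ F g
  ∑-+ f g rewrite ∑≡sum f | ∑≡sum g | ∑≡sum (λ i → f i ⊹ g i) = ∑-distrib-+ f g

  ∑-*ˡ : ∀ {n} s (f : Fin n → Carrier) → ∑ F (λ i → s · f i) ≈ s · ∑ F f
  ∑-*ˡ s f rewrite ∑≡sum f | ∑≡sum (λ i → s · f i) = F.sym (*-distribˡ-sum s f)

  ∑-single : ∀ {n} {f : Fin n → Carrier} i → (∀ j → j ≢ i → f j ≈ 0#) → ∑ F f ≈ f i
  ∑-single {suc n} {f} i f≈0 rewrite ∑≡sum f = F.trans (sum-remove {i = i} f)
    (y≈0⇒x⊹y≈x (F.trans (sum-cong-≋ (λ j → f≈0 (punchIn i j) (punchInᵢ≢i i j))) (sum-replicate-zero n)))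

  infix 5 ∑[_]_

  ∑[_]_ : ∀ {n} → Subset n → (Fin n → Carrier) → Carrier
  ∑[ D ] w = ∑ F λ i → if lookup D i then w i else 0#

  ∑-difference : ∀ {n} {p q : Subset n} (w : Fin n → Carrier) → p ⊆ q →
                 ∑[ q ] w ≈ (∑[ p ] w) ⊹ (∑[ q ─ p ] w)
  ∑-difference {p = []}          {[]}          w p⊆q = F.sym (F.+-identityʳ 0#)
  ∑-difference {p = outside ∷ p} {outside ∷ q} w p⊆q = begin
    0# ⊹ (∑[ q ] (w ∘ suc))                                 ≈⟨ F.+-identityˡ _ ⟩
    ∑[ q ] (w ∘ suc)                                        ≈⟨ ∑-difference (w ∘ suc) (drop-∷-⊆ p⊆q) ⟩
    (∑[ p ] (w ∘ suc)) ⊹ (∑[ q ─ p ] (w ∘ suc))             ≈⟨ F.+-cong (F.+-identityˡ _) (F.+-identityˡ _) ⟨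
    (0# ⊹ (∑[ p ] (w ∘ suc))) ⊹ (0# ⊹ (∑[ q ─ p ] (w ∘ suc)))∎
  ∑-difference {p = outside ∷ p} {inside  ∷ q} w p⊆q = begin
    w zero ⊹ (∑[ q ] (w ∘ suc))                             ≈⟨ F.+-congˡ (∑-difference (w ∘ suc) (drop-∷-⊆ p⊆q)) ⟩
    w zero ⊹ ((∑[ p ] (w ∘ suc)) ⊹ (∑[ q ─ p ] (w ∘ suc)))  ≈⟨ F.+-assoc _ _ _ ⟨
    (w zero ⊹ (∑[ p ] (w ∘ suc))) ⊹ (∑[ q ─ p ] (w ∘ suc))  ≈⟨ F.+-congʳ (F.+-comm _ _) ⟩
    ((∑[ p ] (w ∘ suc)) ⊹ w zero) ⊹ (∑[ q ─ p ] (w ∘ suc))  ≈⟨ F.+-assoc _ _ _ ⟩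
    (∑[ p ] (w ∘ suc)) ⊹ (w zero ⊹ (∑[ q ─ p ] (w ∘ suc)))  ≈⟨ F.+-congʳ (F.+-identityˡ _) ⟨
    (0# ⊹ (∑[ p ] (w ∘ suc))) ⊹ (w zero ⊹ (∑[ q ─ p ] (w ∘ suc)))∎
  ∑-difference {p = inside  ∷ p} {outside ∷ q} w p⊆q with () ← p⊆q here
  ∑-difference {p = inside  ∷ p} {inside  ∷ q} w p⊆q = begin
    w zero ⊹ (∑[ q ] (w ∘ suc))                             ≈⟨ F.+-congˡ (∑-difference (w ∘ suc) (drop-∷-⊆ p⊆q)) ⟩
    w zero ⊹ ((∑[ p ] (w ∘ suc)) ⊹ (∑[ q ─ p ] (w ∘ suc)))  ≈⟨ F.+-assoc _ _ _ ⟨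
    (w zero ⊹ (∑[ p ] (w ∘ suc))) ⊹ (∑[ q ─ p ] (w ∘ suc))  ≈⟨ F.+-congˡ (F.+-identityˡ _) ⟨
    (w zero ⊹ (∑[ p ] (w ∘ suc))) ⊹ (0# ⊹ (∑[ q ─ p ] (w ∘ suc)))∎

  ∑-equal⇒difference-zero : ∀ {n} {p q : Subset n} (w : Fin n → Carrier) → p ⊆ q →
                            ∑[ p ] w ≈ ∑[ q ] w → ∑[ q ─ p ] w ≈ 0#
  ∑-equal⇒difference-zero {p = p} {q} w p⊆q eq =
    GroupProperties.∙-cancelˡ F.+-group (∑[ p ] w) _ _
      (F.trans (F.trans (F.sym (∑-difference w p⊆q)) (F.sym eq)) (F.sym (F.+-identityʳ _)))

  -- Linear relations among the columns of a matrix.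

  module Columns {k m} (A : Matrix F k m) where

    Relation : (Fin m → Carrier) → Set
    Relation c = ∀ row → ∑ F (λ e → c e · A e row) ≈ 0#

    relation-+ : ∀ {c d} → Relation c → Relation d → Relation (λ e → c e ⊹ d e)
    relation-+ {c} {d} Rc Rd row = begin
      ∑ F (λ e → (c e ⊹ d e) · A e row)                    ≈⟨ ∑-cong (λ e → F.distribʳ (A e row) (c e) (d e)) ⟩
      ∑ F (λ e → c e · A e row ⊹ d e · A e row)            ≈⟨ ∑-+ (λ e → c e · A e row) (λ e → d e · A e row) ⟩
      ∑ F (λ e → c e · A e row) ⊹ ∑ F (λ e → d e · A e row) ≈⟨ F.+-cong (Rc row) (Rd row) ⟩
      0# ⊹ 0#                                              ≈⟨ F.+-identityʳ 0# ⟩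
      0#                                                   ∎

    relation-* : ∀ s {c} → Relation c → Relation (λ e → s · c e)
    relation-* s {c} Rc row = begin
      ∑ F (λ e → (s · c e) · A e row)   ≈⟨ ∑-cong (λ e → F.*-assoc s (c e) (A e row)) ⟩
      ∑ F (λ e → s · (c e · A e row))   ≈⟨ ∑-*ˡ s (λ e → c e · A e row) ⟩
      s · ∑ F (λ e → c e · A e row)     ≈⟨ y≈0⇒x·y≈0 (Rc row) ⟩
      0#                                ∎

    relation-0 : Relation (λ _ → 0#)
    relation-0 row = ∑-zero λ e → F.zeroˡ (A e row)

    relation-∑[] : ∀ {n} (D : Subset n) {u : Fin n → Fin m → Carrier} → (∀ i → Relation (u i)) →
                   Relation (λ e → ∑[ D ] (λ i → u i e))
    relation-∑[] []            Ru = relation-0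
    relation-∑[] (inside  ∷ D) Ru = relation-+ (Ru zero) (relation-∑[] D (Ru ∘ suc))
    relation-∑[] (outside ∷ D) Ru = relation-+ relation-0 (relation-∑[] D (Ru ∘ suc))

    SupportedIn : Subset m → (Fin m → Carrier) → Set
    SupportedIn X c = ∀ e → ¬ (e ∈ₛ X) → c e ≈ 0#

    Dependency : Subset m → (Fin m → Carrier) → Set
    Dependency X c = SupportedIn X c × Relation c × ∃[ e ] ¬ (c e ≈ 0#)

    -- A failed universal statement yields no witness constructively, so one is found by searching
    -- all coefficient vectors, coded over `Fin q`.
    dependency : ∀ {X} → ¬ ColsIndependent F A X → ∃ (Dependency X)
    dependency {X} dependent with anyVec? dependency?
      where
      dependency? : Decidable (Dependency X ∘ (element ∘_) ∘ lookup)
      dependency? v =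
        all? (λ e → ¬? (e ∈? X) →-dec element (lookup v e) ≈? 0#) ×-dec
        all? (λ row → _ ≈? 0#) ×-dec
        any? (λ e → ¬? (element (lookup v e) ≈? 0#))
    ... | yes (v , dep) = _ , dep
    ... | no  ¬dep      = contradiction independent dependent
      where
      independent : ColsIndependent F A X
      independent c c-supp Rc e = decidable-stable (c e ≈? 0#) λ ce≉0 → ¬dep
        ( v
        , (λ e′ e′∉X → F.trans (v≈c e′) (c-supp e′ e′∉X))
        , (λ row → F.trans (∑-cong λ e′ → F.*-congʳ (v≈c e′)) (Rc row))
        , e , λ ve≈0 → ce≉0 (F.trans (F.sym (v≈c e)) ve≈0) )
        where
        v = tabulate (index ∘ c)
        v≈c : ∀ e′ → element (lookup v e′) ≈ c e′
        v≈c e′ = F.trans (F.reflexive (cong element (lookup∘tabulate (index ∘ c) e′))) (element-index (c e′))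

    module _ {r : RankFn m} (represented : RepresentedBy F A r) where

      -- The independent subset of size `r X` supplied by the representation is too large to be a
      -- proper subset of `X`.
      full-rank⇒independent : ∀ {X} → ∣ X ∣ ≤ r X → ColsIndependent F A X
      full-rank⇒independent {X} ∣X∣≤r with (Y , Y⊆X , Y-indep , ∣Y∣≡r) , _ ← represented X =
        λ c c-supp → Y-indep c λ e e∉Y → c-supp e λ e∈X → e∉Y (X⊆Y e∈X)
        where
        X⊆Y : X ⊆ Y
        X⊆Y {e} e∈X = decidable-stable (e ∈? Y) λ e∉Y →
          <⇒≱ (p⊂q⇒∣p∣<∣q∣ (Y⊆X , e , e∈X , e∉Y)) (≤-trans ∣X∣≤r (≤-reflexive (sym ∣Y∣≡r)))

      independent⇒full-rank : ∀ {X} → ColsIndependent F A X → ∣ X ∣ ≤ r X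
      independent⇒full-rank {X} X-indep = proj₂ (represented X) X id X-indep

      low-rank⇒dependency : ∀ {X} → r X < ∣ X ∣ → ∃ (Dependency X)
      low-rank⇒dependency r<∣X∣ = dependency λ indep → <⇒≱ r<∣X∣ (independent⇒full-rank indep)

  -- Adding the other element e₀ of leg 0 to a transversal leaves one linear relation up to scale,
  -- and the transversal is a basis iff e₀ has a nonzero coefficient in it.  Switching the legs in
  -- D adds Σ_{i∈D} w i to that coefficient.
  module Switching {n′ k : ℕ} {r : RankFn (suc n′ + suc n′)} (A : Matrix F k (suc n′ + suc n′))
    (represented : RepresentedBy F A r) (isMatroid : IsMatroid r)
    (legRanks : Ground.LegRanks (suc n′) r) (3≤n : 3 ≤ suc n′) where

    open Ground (suc n′)
    open Columns A
    open IsMatroid isMatroid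
    open LegRanks legRanks

    -- A cross exchange with `k ≢ i` is a basis, so it carries no nonzero relation. The uses below
    -- prove a coefficient nonzero by showing that its vanishing would confine a relation to such a
    -- set.
    vanishing : ∀ S {k i c} → k ≢ i → Relation c → SupportedIn (crossExchange S k i) c → ∀ e → c e ≈ 0#
    vanishing S {c = c} k≢i Rc supp = full-rank⇒independent represented
      (≤-trans (≤-reflexive (∣crossExchange∣ {S = S})) (cross S k≢i)) c supp Rc

    module _ (S : Subset (suc n′)) where

      e₀ : Fin (suc n′ + suc n′)
      e₀ = el zero (not (lookup S zero))

      -- Leg zero is left unconstrained: its coefficient at `e₀` is the quantity that decides
      -- whether the transversal is a basis.
      Full : (Fin (suc n′ + suc n′) → Carrier) → Set
      Full c = Relation c
        × (∀ i → c (el (suc i) (not (lookup S (suc i)))) ≈ 0#)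
        × (∀ i → ¬ c (el (suc i) (lookup S (suc i))) ≈ 0#)

      other-leg : Fin n′
      other-leg with other 3≤n zero zero
      ... | zero  , 0≢0 , _ = contradiction refl 0≢0
      ... | suc i , _       = i

      opaque
        -- The transversal with `e₀` has `n + 1` elements and rank at most `n`. A zero coefficient
        -- on leg `i + 1` would leave the relation supported in the cross exchange that empties this
        -- leg and fills leg zero.
        full-relation : ∃ Full
        full-relation = let c , supp , Rc , e , ce≉0 = low-rank⇒dependency represented r<∣X∣ in
          c , Rc , (λ i → supp _ (e₀∉ i)) ,
          λ i c≈0 → ce≉0 (vanishing S {k = suc i} {zero} (λ ()) Rc (supp′ supp i c≈0) e)
          where
          T X : Subset (suc n′ + suc n′)
          T = transversal S
          X = T ∪ ⁅ e₀ ⁆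
          r<∣X∣ : r X < ∣ X ∣
          r<∣X∣ = ≤-trans (s≤s (≤-trans (monotone X ⊤ ⊆⊤) rank≤n))
            (≤-reflexive (sym (trans (x∉p⇒∣p∪⁅x⁆∣≡1+∣p∣ (el-other∉transversal {S} zero))
                                     (cong suc (∣transversal∣ S)))))
          e₀∉ : ∀ i → el (suc i) (not (lookup S (suc i))) ∉ₛ X
          e₀∉ i e∈ with x∈p∪q⁻ T ⁅ e₀ ⁆ e∈
          ... | inj₁ e∈T  = el-other∉transversal {S} (suc i) e∈T
          ... | inj₂ e∈e₀ with () ← el-injectiveˡ _ _ (x∈⁅y⁆⇒x≡y e₀ e∈e₀)
          supp′ : ∀ {c} → SupportedIn X c → ∀ i → c (el (suc i) (lookup S (suc i))) ≈ 0# →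
                  SupportedIn (crossExchange S (suc i) zero) c
          supp′ supp i c≈0 e e∉ with e Fin.≟ el (suc i) (lookup S (suc i))
          ... | yes refl = c≈0
          ... | no  e≢   = supp e λ e∈X →
            [ (λ e∈T → e∉ (∈exchange e∈T e≢))
            , (λ e∈e₀ → e∉ (subst (_∈ₛ crossExchange S (suc i) zero) (sym (x∈⁅y⁆⇒x≡y e₀ e∈e₀)) ∈exchange-new))
            ]′ (x∈p∪q⁻ T ⁅ e₀ ⁆ e∈X)

      module _ c (full : Full c) where

        private
          Rc  = proj₁ full
          off = proj₁ (proj₂ full)
          on  = proj₂ (proj₂ full)

        -- With coefficient zero at `e₀` the relation would live on an independent transversal, yet
        -- it is nonzero on `other-leg`.
        spanning⇒c[e₀]≉0 : suc n′ ≤ r (transversal S) → ¬ c e₀ ≈ 0#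
        spanning⇒c[e₀]≉0 n≤r c₀≈0 = on other-leg (full-rank⇒independent represented
          (≤-trans (≤-reflexive (∣transversal∣ S)) n≤r) c supp Rc _)
          where
          supp : SupportedIn (transversal S) c
          supp e e∉ with view e
          ... | ⟨ i , β ⟩ with refl ← el∉transversal⇒other {S} β e∉ with i
          ...   | zero   = c₀≈0
          ...   | suc i′ = off i′

        -- Given a relation `d` on the transversal, a multiple of `c` clears its coefficient on leg
        -- `l`. The sum lives on a cross exchange, so it vanishes; reading it at `e₀`, where `d` is
        -- zero, shows the multiple to be zero, whence `d` is zero.
        c[e₀]≉0⇒spanning : ¬ c e₀ ≈ 0# → suc n′ ≤ r (transversal S)
        c[e₀]≉0⇒spanning c₀≉0 = ≤-trans (≤-reflexive (sym (∣transversal∣ S)))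
          (independent⇒full-rank represented independent)
          where
          l = suc other-leg
          eₗ = el l (lookup S l)
          independent : ColsIndependent F A (transversal S)
          independent d d-supp Rd e with s , eq ← cancel (d eₗ) (on other-leg) = begin
            d e               ≈⟨ y≈0⇒x⊹y≈x (F.trans (F.*-congʳ s≈0) (F.zeroˡ (c e))) ⟨
            d e ⊹ s · c e     ≈⟨ d+sc≈0 e ⟩
            0#                ∎
            where
            supp : SupportedIn (crossExchange S l zero) (λ e → d e ⊹ s · c e)
            supp e e∉ with e ∈? transversal S
            ... | yes e∈T with e Fin.≟ eₗ
            ...   | yes refl = eq
            ...   | no  e≢   = contradiction (∈exchange e∈T e≢) e∉
            supp e e∉ | no e∉T with view e
            ...   | ⟨ i , β ⟩ with refl ← el∉transversal⇒other {S} β e∉T with i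
            ...     | zero   = contradiction ∈exchange-new e∉
            ...     | suc i′ = F.trans (x≈0⇒x⊹y≈y (d-supp _ e∉T)) (y≈0⇒x·y≈0 (off i′))
            d+sc≈0 : ∀ e → d e ⊹ s · c e ≈ 0#
            d+sc≈0 = vanishing S (λ ()) (relation-+ {d} {λ e → s · c e} Rd (relation-* s {c} Rc)) supp
            s≈0 : s ≈ 0#
            s≈0 = x·z≈0⇒x≈0 c₀≉0 (F.trans
              (F.sym (x≈0⇒x⊹y≈y (d-supp e₀ (el-other∉transversal {S} zero)))) (d+sc≈0 e₀))

    -- Legs zero and `i + 1` have four elements and rank at most 3. Were a coefficient on leg
    -- `i + 1` zero, the other three elements would lie in a cross exchange.
    leg-relation : ∀ i → ∃[ u ] Relation u
                   × (∀ {j} β → j ≢ i → u (el (suc j) β) ≈ 0#)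
                   × (∀ β → ¬ u (el (suc i) β) ≈ 0#)
    leg-relation i = let u , supp , Ru , e , ue≉0 = low-rank⇒dependency represented r<∣X∣ in
      u , Ru
        , (λ β j≢i → supp _ λ e∈ → [ (λ ()) ∘ x∈⁅y⁆⇒x≡y zero , j≢i ∘ Fin.suc-injective ∘ x∈⁅y⁆⇒x≡y (suc i) ]′
                                     (x∈p∪q⁻ ⁅ zero ⁆ ⁅ suc i ⁆ (el∈legs⁻ J e∈)))
        , λ β uβ≈0 → ue≉0 (vanish supp Ru β uβ≈0 e)
      where
      J : Subset (suc n′)
      J = ⁅ zero ⁆ ∪ ⁅ suc i ⁆
      r<∣X∣ : r (legs J) < ∣ legs J ∣
      r<∣X∣ = ≤-trans (s≤s (two-legs {zero} {suc i} (λ ())))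
        (≤-reflexive (sym (trans (∣++∣ J J) (cong₂ _+_ ∣J∣≡2 ∣J∣≡2))))
        where
        ∣J∣≡2 : ∣ J ∣ ≡ 2
        ∣J∣≡2 = ∣⁅x⁆∪⁅y⁆∣≡2 {x = zero} {suc i} λ ()
      vanish : ∀ {u} → SupportedIn (legs J) u → Relation u → ∀ β → u (el (suc i) β) ≈ 0# → ∀ e → u e ≈ 0#
      vanish {u} supp Ru β uβ≈0 with k , k≢0 , k≢i ← other 3≤n zero (suc i) =
        vanishing S′ k≢0 Ru supp′
        where
        S′ : Subset (suc n′)
        -- Only the entry at leg `i + 1` matters: it selects the element opposite to `β`. The third
        -- leg `k` is emptied to make room for all of leg zero.
        S′ = replicate (suc n′) (not β)
        supp′ : SupportedIn (crossExchange S′ k zero) u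
        supp′ e e∉ with view e
        ... | ⟨ j , γ ⟩ with j ∈? J
        ...   | no  j∉J = supp _ (j∉J ∘ el∈legs⁻ J)
        ...   | yes j∈J with x∈p∪q⁻ ⁅ zero ⁆ ⁅ suc i ⁆ j∈J
        ...     | inj₁ j∈0 with refl ← x∈⁅y⁆⇒x≡y zero j∈0 = contradiction (leg⊆crossExchange {S = S′} k≢0 γ) e∉
        ...     | inj₂ j∈i with refl ← x∈⁅y⁆⇒x≡y (suc i) j∈i | γ Bool.≟ β
        ...       | yes refl = uβ≈0
        ...       | no  γ≢β  = contradiction
          (∈exchange (el∈transversal⁺ (trans (lookup-replicate (suc i) (not β)) (sym (¬-not γ≢β))))
                     (k≢i ∘ sym ∘ el-injectiveˡ _ _)) e∉

    module _ (S : Subset (suc n′)) where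

      c₀ : Fin (suc n′ + suc n′) → Carrier
      c₀ = proj₁ (full-relation S)

      opaque
        -- The relation on legs zero and `i + 1` is scaled to clear `c₀` at the chosen element of
        -- leg `i + 1`. The scale is nonzero because `c₀` is nonzero there.
        canceller : ∀ i → ∃[ v ] Relation v
                    × (∀ {j} β → j ≢ i → v (el (suc j) β) ≈ 0#)
                    × c₀ (el (suc i) (lookup S (suc i))) ⊹ v (el (suc i) (lookup S (suc i))) ≈ 0#
                    × ¬ v (el (suc i) (not (lookup S (suc i)))) ≈ 0#
        canceller i with u , Ru , u-off , u-on ← leg-relation i
          with s , eq ← cancel (c₀ (el (suc i) (lookup S (suc i)))) (u-on (lookup S (suc i))) =
          (λ e → s · u e) , relation-* s {u} Ru , (λ β j≢i → y≈0⇒x·y≈0 (u-off β j≢i)) , eq ,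
          λ su≈0 → proj₂ (proj₂ (proj₂ (full-relation S))) i
            (F.trans (F.sym (y≈0⇒x⊹y≈x (F.trans (F.*-congʳ (x·z≈0⇒x≈0 (u-on _) su≈0)) (F.zeroˡ _)))) eq)

      v : Fin n′ → Fin (suc n′ + suc n′) → Carrier
      v = proj₁ ∘ canceller

      weight : Fin n′ → Carrier
      weight i = v i (e₀ S)

      -- v i moves the support of c₀ from one element of leg i + 1 to the other.
      switched : Subset n′ → Fin (suc n′ + suc n′) → Carrier
      switched D e = c₀ e ⊹ (∑[ D ] λ i → v i e)

      -- Leg zero is never switched, so `e₀` is the same element before and after and the
      -- coefficients there can be compared.
      flip : Subset n′ → Subset (suc n′)
      flip D = S ⊕ (outside ∷ D)

      private
        vanishing-summand : ∀ (D : Subset n′) i {x} → x ≈ 0# → (if lookup D i then x else 0#) ≈ 0#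
        vanishing-summand D i x≈0 with lookup D i
        ... | true  = x≈0
        ... | false = F.refl

      -- Outside leg zero `v i` lives on leg `i + 1` only, so each leg sees a single summand and one
      -- bit of `D`.
      switched-leg : ∀ D j β → switched D (el (suc j) β) ≈
                     c₀ (el (suc j) β) ⊹ (if lookup D j then v j (el (suc j) β) else 0#)
      switched-leg D j β = F.+-congˡ (∑-single j λ i i≢j →
        vanishing-summand D i (proj₁ (proj₂ (proj₂ (canceller i))) β (i≢j ∘ sym)))

      switched-full : ∀ D → Full (flip D) (switched D)
      switched-full D with R₀ , off₀ , on₀ ← proj₂ (full-relation S) =
        relation-+ {c₀} {λ e → ∑[ D ] λ i → v i e} R₀ (relation-∑[] D {v} (proj₁ ∘ proj₂ ∘ canceller)) , off , on
        where
        entry : Fin n′ → Bool → Bool → Carrier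
        entry j β b = c₀ (el (suc j) β) ⊹ (if b then v j (el (suc j) β) else 0#)

        off-entry : ∀ j b → entry j (not (lookup S (suc j) xor b)) b ≈ 0#
        off-entry j false rewrite xor-identityʳ (lookup S (suc j)) = F.trans (F.+-identityʳ _) (off₀ j)
        off-entry j true  =
          subst (λ β → entry j β true ≈ 0#)
            (sym (trans (cong not (xor-trueʳ (lookup S (suc j)))) (not-involutive (lookup S (suc j)))))
            (proj₁ (proj₂ (proj₂ (proj₂ (canceller j)))))

        on-entry : ∀ j b → ¬ entry j (lookup S (suc j) xor b) b ≈ 0#
        on-entry j false eq rewrite xor-identityʳ (lookup S (suc j)) =
          on₀ j (F.trans (F.sym (F.+-identityʳ _)) eq)
        on-entry j true  eq rewrite xor-trueʳ (lookup S (suc j)) =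
          proj₂ (proj₂ (proj₂ (proj₂ (canceller j)))) (F.trans (F.sym (x≈0⇒x⊹y≈y (off₀ j))) eq)

        off : ∀ j → switched D (el (suc j) (not (lookup (flip D) (suc j)))) ≈ 0#
        off j rewrite lookup-⊕ S (outside ∷ D) (suc j) =
          F.trans (switched-leg D j _) (off-entry j (lookup D j))

        on : ∀ j → ¬ switched D (el (suc j) (lookup (flip D) (suc j))) ≈ 0#
        on j eq rewrite lookup-⊕ S (outside ∷ D) (suc j) =
          on-entry j (lookup D j) (F.trans (F.sym (switched-leg D j _)) eq)

      switched-e₀ : ∀ D → ∑[ D ] weight ≈ 0# → switched D (e₀ (flip D)) ≈ c₀ (e₀ S)
      switched-e₀ D ∑w≈0 rewrite lookup-⊕ S (outside ∷ D) zero | xor-identityʳ (lookup S zero) =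
        y≈0⇒x⊹y≈x ∑w≈0

      flip-preserves-spanning : ∀ D → ∑[ D ] weight ≈ 0# →
        suc n′ ≤ r (transversal S) → suc n′ ≤ r (transversal (flip D))
      flip-preserves-spanning D ∑w≈0 n≤r = c[e₀]≉0⇒spanning (flip D) (switched D) (switched-full D)
        (spanning⇒c[e₀]≉0 S c₀ (proj₂ (full-relation S)) n≤r ∘ F.trans (F.sym (switched-e₀ D ∑w≈0)))

      flip-reflects-spanning : ∀ D → ∑[ D ] weight ≈ 0# →
        suc n′ ≤ r (transversal (flip D)) → suc n′ ≤ r (transversal S)
      flip-reflects-spanning D ∑w≈0 n≤r = c[e₀]≉0⇒spanning S c₀ (proj₂ (full-relation S))
        (spanning⇒c[e₀]≉0 (flip D) (switched D) (switched-full D) n≤r ∘ F.trans (switched-e₀ D ∑w≈0))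

-- Zero sums by the pigeonhole principle.

initial : ∀ {n} → Fin (suc n) → Subset n
initial         zero    = ⊥
initial {suc n} (suc i) = inside ∷ initial i

initial-⊂ : ∀ {n} {i j : Fin (suc n)} → i Fin.< j → initial i ⊂ initial j
initial-⊂ {suc n} {zero}  {suc j} _         = out⊂in ⊥⊆
initial-⊂ {suc n} {suc i} {suc j} (s≤s i<j) = in⊂in (initial-⊂ i<j)

module _ {q} (F₁ F₂ : CommutativeRing 0ℓ 0ℓ) (isField₁ : IsField F₁) (isField₂ : IsField F₂)
  (hasOrder₁ : HasOrder F₁ q) (hasOrder₂ : HasOrder F₂ q) where

  private
    module F₁ = CommutativeRing F₁
    module F₂ = CommutativeRing F₂
    module FF₁ = FiniteField F₁ isField₁ hasOrder₁
    module FF₂ = FiniteField F₂ isField₂ hasOrder₂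

  -- Two of the n + 1 initial segments have equal sums for both weights; take their difference.
  common-zero-sum : ∀ {n} → q * q < suc n → (w₁ : Fin n → F₁.Carrier) (w₂ : Fin n → F₂.Carrier) →
    ∃[ D ] Nonempty D × (FF₁.∑[ D ] w₁) F₁.≈ F₁.0# × (FF₂.∑[ D ] w₂) F₂.≈ F₂.0#
  common-zero-sum q²≤n w₁ w₂
    with i , j , i<j , eq ← pigeonhole q²≤n (λ i →
           combine (FF₁.index (FF₁.∑[ initial i ] w₁)) (FF₂.index (FF₂.∑[ initial i ] w₂)))
    with eq₁ , eq₂ ← combine-injective _ _ _ _ eq
       | i⊆j , x , x∈j , x∉i ← initial-⊂ i<j =
    initial j ─ initial i , (x , x∈p∧x∉q⇒x∈p─q x∈j x∉i) ,
    FF₁.∑-equal⇒difference-zero w₁ i⊆j (FF₁.index-injective eq₁) ,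
    FF₂.∑-equal⇒difference-zero w₂ i⊆j (FF₂.index-injective eq₂)

-- Counting lists that cover all subsets.

length-cartesianProductWith : ∀ {A B C : Set} (f : A → B → C) xs ys →
                              length (cartesianProductWith f xs ys) ≡ length xs * length ys
length-cartesianProductWith f []       ys = refl
length-cartesianProductWith f (x ∷ xs) ys = trans (length-++ (map (f x) ys))
  (cong₂ _+_ (length-map (f x) ys) (length-cartesianProductWith f xs ys))

tails : ∀ {n} → Bool → List (Subset (suc n)) → List (Subset n)
tails b     []                   = []
tails true  ((true  ∷ p) ∷ ps)   = p ∷ tails true ps
tails true  ((false ∷ p) ∷ ps)   = tails true ps
tails false ((true  ∷ p) ∷ ps)   = tails false ps
tails false ((false ∷ p) ∷ ps)   = p ∷ tails false ps

∈-tails : ∀ {n} b {p : Subset n} {ps} → (b ∷ p) ∈ ps → p ∈ tails b ps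
∈-tails true  {ps = (true  ∷ _) ∷ _} (here refl) = here refl
∈-tails true  {ps = (true  ∷ _) ∷ _} (there p∈)  = there (∈-tails true p∈)
∈-tails true  {ps = (false ∷ _) ∷ _} (there p∈)  = ∈-tails true p∈
∈-tails false {ps = (false ∷ _) ∷ _} (here refl) = here refl
∈-tails false {ps = (false ∷ _) ∷ _} (there p∈)  = there (∈-tails false p∈)
∈-tails false {ps = (true  ∷ _) ∷ _} (there p∈)  = ∈-tails false p∈

length-tails : ∀ {n} (ps : List (Subset (suc n))) →
               length (tails true ps) + length (tails false ps) ≡ length ps
length-tails []                 = refl
length-tails ((true  ∷ _) ∷ ps) = cong suc (length-tails ps)
length-tails ((false ∷ _) ∷ ps) = trans (+-suc _ _) (cong suc (length-tails ps))

-- Sorting the list by first entry gives two lists of the same total length, each covering the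
-- subsets of a set one smaller; repetitions do no harm.
covering⇒2^n≤length : ∀ {n} (ps : List (Subset n)) → (∀ p → p ∈ ps) → 2 ^ n ≤ length ps
covering⇒2^n≤length {zero}  ps covering with covering []
... | here _  = s≤s z≤n
... | there _ = s≤s z≤n
covering⇒2^n≤length {suc n} ps covering = begin
  2 ^ n + (2 ^ n + 0)                                  ≡⟨ cong (2 ^ n +_) (+-identityʳ (2 ^ n)) ⟩
  2 ^ n + 2 ^ n                                        ≤⟨ +-mono-≤ (half true) (half false) ⟩
  length (tails true ps) + length (tails false ps)     ≡⟨ length-tails ps ⟩
  length ps                                            ∎
  where
  open ≤-Reasoning
  half : ∀ b → 2 ^ n ≤ length (tails b ps)
  half b = covering⇒2^n≤length (tails b ps) λ p → ∈-tails b (covering (b ∷ p))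

-- Which transversals a certificate must contain.

module _ {q n′ : ℕ} (3≤n : 3 ≤ suc n′) (q²<n : q * q < suc n′) where

  open Ground (suc n′)

  module _ {r₁ r₂} (M₁ : IsMatroid r₁) (M₂ : IsMatroid r₂) (L₁ : LegRanks r₁) (L₂ : LegRanks r₂)
    (rep₁ : GFRepresentable q r₁) (rep₂ : GFRepresentable q r₂) where

    -- Switching along a nonempty `D` of zero sum for both weights keeps the status of the
    -- transversal in either representation, and at the switched transversal the two rank functions
    -- coincide.
    representations-agree : ∀ {S} → (∀ {X} → X ≢ transversal S → r₁ X ≡ r₂ X) →
                            suc n′ ≤ r₁ (transversal S) → suc n′ ≤ r₂ (transversal S)
    representations-agree {S} agree n≤r₁T =
      let F₁ , field₁ , order₁ , _ , A₁ , represents₁ = rep₁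
          F₂ , field₂ , order₂ , _ , A₂ , represents₂ = rep₂
          module W₁ = FiniteField.Switching F₁ field₁ order₁ A₁ represents₁ M₁ L₁ 3≤n
          module W₂ = FiniteField.Switching F₂ field₂ order₂ A₂ represents₂ M₂ L₂ 3≤n
          D , D≢∅ , zero₁ , zero₂ =
            common-zero-sum F₁ F₂ field₁ field₂ order₁ order₂ q²<n (W₁.weight S) (W₂.weight S)
      in W₂.flip-reflects-spanning S D zero₂
           (subst (suc n′ ≤_) (agree (flip≢ D≢∅)) (W₁.flip-preserves-spanning S D zero₁ n≤r₁T))
      where
      flip≢ : ∀ {D} → Nonempty D → transversal (S ⊕ (outside ∷ D)) ≢ transversal S
      flip≢ {D} (i , i∈D) eq = el-other∉transversal {S} (suc i)
        (subst (el (suc i) (not (lookup S (suc i))) ∈ₛ_) eq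
          (el∈transversal⁺ (lookup-⊕-∈ {S} {outside ∷ D} (Vec.there i∈D))))

  module Certificate {r} (isSpike : IsSpike (suc n′) r) (𝒳 : List (Subset (suc n′ + suc n′)))
    (certifies : (r′ : RankFn (suc n′ + suc n′)) → IsMatroid r′ →
                 (∀ X → X ∈ 𝒳 → r′ X ≡ r X) → GFRepresentable q r′) where

    open Spike isSpike

    private
      n = suc n′

      _∈𝒳? : ∀ X → Dec (X ∈ 𝒳)
      X ∈𝒳? = ∈?ˡ _≟ₛ_ X 𝒳

    -- If `T` were absent from `𝒳`, the certificate would apply to `r` and to its redefinition at
    -- `T` alike, and the two representations would have to agree on whether `T` is a basis.
    redefinable⇒∈𝒳 : ∀ {S} → (∀ i → n ≤ r (transversal (S ⊕ ⁅ i ⁆))) → transversal S ∈ 𝒳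
    redefinable⇒∈𝒳 {S} neighbours = decidable-stable (T ∈𝒳?) contradictory
      where
      T = transversal S

      redefined : ∀ {v} → v ≤ n → n ≤ suc v → IsMatroid (r [ T ↦ v ])
      redefined {v} v≤n n≤1+v = Redefine.isMatroid isMatroid
        (subst (r ⊤ ≤_) (sym (∣transversal∣ S)) (LegRanks.rank≤n legRanks))
        (el zero (not (lookup S zero))) (el-other∉transversal {S} zero)
        (λ {k} {e} k∈ e∉ → subst (_≤ r (exchange T k e)) (sym (∣transversal∣ S))
          (exchanges-spanning 3≤n isMatroid legRanks neighbours k∈ e∉))
        (subst (v ≤_) (sym (∣transversal∣ S)) v≤n)
        (subst (_≤ suc v) (sym (∣transversal∣ S)) n≤1+v)

      module _ (T∉𝒳 : ¬ T ∈ 𝒳) where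

        represented : GFRepresentable q r
        represented = certifies r isMatroid λ _ _ → refl

        redefined-represented : ∀ {v} → v ≤ n → n ≤ suc v → GFRepresentable q (r [ T ↦ v ])
        redefined-represented v≤n n≤1+v = certifies _ (redefined v≤n n≤1+v)
          λ X X∈𝒳 → ↦-miss λ X≡T → T∉𝒳 (subst (_∈ 𝒳) X≡T X∈𝒳)

        rank-unchanged : ∀ {v} → v ≤ n → n ≤ suc v → (n ≤ r T → n ≤ v) × (n ≤ v → n ≤ r T)
        rank-unchanged {v} v≤n n≤1+v =
          subst (n ≤_) hit ∘
            representations-agree isMatroid M′ legRanks L′ represented rep′ (λ X≢T → sym (↦-miss X≢T)) ,
          representations-agree M′ isMatroid L′ legRanks rep′ represented ↦-miss ∘
            subst (n ≤_) (sym hit)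
          where
          hit = ↦-hit {r = r} {T} {v}
          M′ = redefined v≤n n≤1+v
          L′ = LegRanks-redefine 3≤n legRanks S v
          rep′ = redefined-represented v≤n n≤1+v

        contradictory : ⊥ᵉ
        contradictory with n ≤? r T
        -- A basis is lowered to rank `n - 1`; in the other case the rank is raised to `n`. Either
        -- way the status of `T` changes.
        ... | yes n≤rT = 1+n≰n (proj₁ (rank-unchanged (n≤1+n n′) ≤-refl) n≤rT)
        ... | no  n≰rT = n≰rT (proj₂ (rank-unchanged ≤-refl (n≤1+n n)) ≤-refl)

    shifts : List (Subset n)
    shifts = ⊥ ∷ map ⁅_⁆ (allFin n)

    -- If some neighbour is dependent, all of that neighbour's own neighbours are bases, so it is
    -- redefinable; otherwise the transversal of `S` is redefinable itself.
    near-𝒳 : ∀ S → ∃[ D ] D ∈ shifts × transversal (S ⊕ D) ∈ 𝒳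
    near-𝒳 S with any? (λ i → r (transversal (S ⊕ ⁅ i ⁆)) <? n)
    ... | yes (i , dependent) = ⁅ i ⁆ , there (∈-map⁺ ⁅_⁆ (∈-allFin i)) ,
          redefinable⇒∈𝒳 (neighbour-spanning 3≤n isMatroid legRanks dependent)
    ... | no  ¬dependent      = ⊥ , here refl , subst (λ S′ → transversal S′ ∈ 𝒳) (sym (⊕-identityʳ S))
          (redefinable⇒∈𝒳 λ i → ≮⇒≥ λ dependent → ¬dependent (i , dependent))

    -- `drop n` reads `S` off `transversal S`. On members of `𝒳` that are not transversals the value
    -- is arbitrary, which can only lengthen the covering list.
    unshift : Subset (n + n) → Subset n → Subset n
    unshift X D = drop n X ⊕ D

    unshift-surjective : ∀ S → S ∈ cartesianProductWith unshift 𝒳 shifts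
    unshift-surjective S with D , D∈ , T∈ ← near-𝒳 S =
      subst (_∈ cartesianProductWith unshift 𝒳 shifts)
        (trans (cong (_⊕ D) (drop-transversal (S ⊕ D))) (⊕-cancelʳ S D))
        (∈-cartesianProductWith⁺ unshift T∈ D∈)

    2^n≤∣𝒳∣*1+n : 2 ^ n ≤ length 𝒳 * suc n
    2^n≤∣𝒳∣*1+n = begin
      2 ^ n                                             ≤⟨ covering⇒2^n≤length _ unshift-surjective ⟩
      length (cartesianProductWith unshift 𝒳 shifts)    ≡⟨ length-cartesianProductWith unshift 𝒳 shifts ⟩
      length 𝒳 * length shifts                          ≡⟨ cong (λ l → length 𝒳 * suc l)
                                                             (trans (length-map ⁅_⁆ (allFin n)) (length-tabulate id)) ⟩
      length 𝒳 * suc n                                  ∎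
      where open ≤-Reasoning

-- Numerical estimates and conclusion.

[7+k]²≤2^[6+k] : ∀ k → (7 + k) * (7 + k) ≤ 2 ^ (6 + k)
[7+k]²≤2^[6+k] zero    = m≤m+n 49 15
[7+k]²≤2^[6+k] (suc k) = begin
  (8 + k) * (8 + k)                                ≤⟨ m≤m+n _ _ ⟩
  -- The added term is the slack `2(7 + k)² - (8 + k)²`.
  (8 + k) * (8 + k) + (34 + 12 * k + k * k)        ≡⟨ expand k ⟩
  2 * ((7 + k) * (7 + k))                          ≤⟨ *-monoʳ-≤ 2 ([7+k]²≤2^[6+k] k) ⟩
  2 ^ (7 + k)                                      ∎
  where
  open ≤-Reasoning
  expand : ∀ k → (8 + k) * (8 + k) + (34 + 12 * k + k * k) ≡ 2 * ((7 + k) * (7 + k))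
  expand = solve-∀

-- The threshold 6 is forced by the failure at `n = 5`, where 36 exceeds 32.
[1+n]²≤2^n : ∀ {n} → 6 ≤ n → suc n * suc n ≤ 2 ^ n
[1+n]²≤2^n {n} 6≤n = subst (λ m → suc m * suc m ≤ 2 ^ m) (m+[n∸m]≡n 6≤n) ([7+k]²≤2^[6+k] (n ∸ 6))

-- Squaring the hypothesis gives `4^n ≤ l²(n + 1)² ≤ l² 2^n`, and a factor `2^n` cancels. The
-- conclusion is the squared form of `l ≥ 2^(n/2)`.
2^n≤l*1+n⇒2^n≤l² : ∀ {n l} → 6 ≤ n → 2 ^ n ≤ l * suc n → 2 ^ n ≤ l * l
2^n≤l*1+n⇒2^n≤l² {n} {l} 6≤n le = *-cancelʳ-≤ (2 ^ n) (l * l) (2 ^ n) {{m^n≢0 2 n}} (begin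
  2 ^ n * 2 ^ n                ≤⟨ *-mono-≤ le le ⟩
  (l * suc n) * (l * suc n)    ≡⟨ [m*n]*[o*p]≡[m*o]*[n*p] l (suc n) l (suc n) ⟩
  (l * l) * (suc n * suc n)    ≤⟨ *-monoʳ-≤ (l * l) ([1+n]²≤2^n 6≤n) ⟩
  (l * l) * 2 ^ n              ∎)
  where open ≤-Reasoning

primePower≥2 : ∀ {q} → IsPrimePower q → 2 ≤ q
primePower≥2 (p , k , p-prime , 1≤k , refl) = begin
  2      ≤⟨ nonTrivial⇒n>1 p ⟩
  p      ≡⟨ sym (^-identityʳ p) ⟩
  p ^ 1  ≤⟨ ^-monoʳ-≤ p 1≤k ⟩
  p ^ k  ∎
  where
  open ≤-Reasoning
  instance
    _ = prime⇒nonTrivial p-prime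
    _ = prime⇒nonZero p-prime

theorem2p1 : (q : ℕ) → IsPrimePower q → (n : ℕ) → q ^ 3 < n →
    (rM : RankFn (n + n)) → IsSpike n rM →
    (𝒳 : List (Subset (n + n))) → Unique 𝒳 →
    ((rN : RankFn (n + n)) → IsMatroid rN →
    (∀ X → X ∈ 𝒳 → rN X ≡ rM X) → GFRepresentable q rN) →
    2 ^ n ≤ length 𝒳 * length 𝒳
theorem2p1 q q-primePower n@(suc _) q³<n rM isSpike 𝒳 _ certifies =
  2^n≤l*1+n⇒2^n≤l² {l = length 𝒳} (≤-trans (m≤m+n 6 3) 9≤n)
    (Certificate.2^n≤∣𝒳∣*1+n (≤-trans (m≤m+n 3 6) 9≤n) q²<n isSpike 𝒳 certifies)
  where
  instance
    q≢0 : NonZero q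
    q≢0 = >-nonZero (≤-trans (s≤s z≤n) (primePower≥2 q-primePower))
  -- From `q ≥ 2` comes `n > q³ ≥ 8`, enough for both the three legs and the numerical threshold 6.
  9≤n : 9 ≤ n
  9≤n = ≤-<-trans (^-monoˡ-≤ 3 (primePower≥2 q-primePower)) q³<n
  q²<n : q * q < n
  q²<n = ≤-<-trans (begin
    q * q              ≤⟨ *-monoʳ-≤ q (m≤m*n q q) ⟩
    q * (q * q)        ≡⟨ cong (λ x → q * (q * x)) (sym (*-identityʳ q)) ⟩
    q ^ 3              ∎) q³<n
    where open ≤-Reasoning
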